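{- For every odd positive integer $d$ and every even integer $h_0>3$ there exists a minimal graph $G$ with diameter $d$ and $\mathrm{HG}(G)=h_0$.
   Context: All graphs are finite and simple. A generalized hat guessing game is a triple $\langle G,h,g\rangle$ where $G=(V,E)$ is a graph and $h,g:V\to\mathbb{Z}_{>0}$. An adversary assigns to each vertex $v$ a color $c(v)\in\{0,\dots,h(v)-1\}$; each vertex $v$ sees the colors of its neighbours and, by a deterministic strategy fixed in advance (a function of the neighbours' colors), outputs a set of $g(v)$ guesses for its own color. The strategy is winning if for every coloring at least one vertex $v$ has $c(v)$ among its guesses; the game is winning if a winning strategy exists. For a positive integer $m$, $\star m$ denotes the constant function $m$, and $\langle G,h\rangle$ means $\langle G,h,\star 1\rangle$. $\mathrm{HG}(G)$ is the largest $k$ such that $\langle G,\star k\rangle$ is winning. Signed independence polynomial: for variables $\mathbf{x}=(x_v)_{v\in V}$, $Z_G(\mathbf{x})=\sum_{I}\prod_{v\in I}(-x_v)$, the sum over all independent sets $I$ of $G$ (including $\emptyset$, contributing $1$). For vectors, $\mathbf{x}\le\mathbf{y}$ means coordinatewise inequality. A game $\langle G,h,g\rangle$ is maximal if, with $\mathbf{r}=(g(v)/h(v))_{v\in V}$, we have $Z_G(\mathbf{r})=0$ and $Z_G(\mathbf{x})>0$ for every real vector $\mathbf{x}$ with $\mathbf{0}\le\mathbf{x}\le\mathbf{r}$, $\mathbf{x}\ne\mathbf{r}$. A graph $G$ with $h_0=\mathrm{HG}(G)$ is called minimal if $\mathrm{HG}(G_0)<h_0$ for every proper subgraph $G_0$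 of $G$ and the game $\langle G,\star h_0\rangle$ is maximal.
   Formalization: In the definition of a maximal game, positivity of the signed independence polynomial is required only for rational vectors x with 0 ≤ x ≤ r, x ≠ r, instead of all real ones; the real form follows by continuity and monotonicity. -}

module Defs where

open import Data.Nat as ℕ using (ℕ; zero; suc; _<_; _≤_; NonZero)
open import Data.Fin using (Fin; zero; suc)
open import Data.Bool using (Bool; true; false; _∧_; not; if_then_else_)
open import Data.List using (List; []; _∷_; _++_; map; filter; foldr; allFin)
open import Data.List.Relation.Unary.All using (All)
open import Data.Integer using (+_)
open import Data.Rational as ℚ using (ℚ; 0ℚ; 1ℚ; _/_)
open import Data.Product using (Σ; ∃; ∃-syntax; _×_; _,_)
open import Data.Sum using (_⊎_)
open import Relation.Binary.PropositionalEquality using (_≡_)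
open import Relation.Nullary using (¬_)

record Graph (n : ℕ) : Set where
  field
    adj    : Fin n → Fin n → Bool
    sym    : ∀ u v → adj u v ≡ adj v u
    irrefl : ∀ v → adj v v ≡ false
open Graph public

Colouring : {n : ℕ} → (Fin n → ℕ) → Set
Colouring {n} h = (v : Fin n) → Fin (h v)

Strategy : {n : ℕ} → Graph n → (Fin n → ℕ) → Set
Strategy {n} G h =
  Σ ((v : Fin n) → Colouring h → Fin (h v)) λ f →
    ∀ v (c c′ : Colouring h) →
      (∀ u → adj G v u ≡ true → c u ≡ c′ u) → f v c ≡ f v c′

Winning : {n : ℕ} → Graph n → (Fin n → ℕ) → Set
Winning {n} G h =
  Σ (Strategy G h) λ s → ∀ (c : Colouring h) → ∃[ v ] (Data.Product.proj₁ s v c ≡ c v)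

★ : {n : ℕ} → ℕ → Fin n → ℕ
★ m _ = m

HGis : {n : ℕ} → Graph n → ℕ → Set
HGis G k = Winning G (★ k) × (∀ m → k < m → ¬ Winning G (★ m))

record ProperSubgraph {n : ℕ} (G : Graph n) : Set where
  field
    m      : ℕ
    H      : Graph m
    ι      : Fin m → Fin n
    ι-inj  : ∀ a b → ι a ≡ ι b → a ≡ b
    edges  : ∀ a b → adj H a b ≡ true → adj G (ι a) (ι b) ≡ true
    proper : (m < n) ⊎ (∃[ a ] ∃[ b ] (adj G (ι a) (ι b) ≡ true × adj H a b ≡ false))

-- Signed independence polynomial Z_G(x) = Σ_I Π_{v∈I} (-x_v)

subsets : (n : ℕ) → List (Fin n → Bool)
subsets zero    = (λ ()) ∷ []
subsets (suc n) = Data.List.concatMap (λ s → ext false s ∷ ext true s ∷ []) (subsets n)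
  where
  ext : Bool → (Fin n → Bool) → Fin (suc n) → Bool
  ext b s zero    = b
  ext b s (suc i) = s i

all? : {A : Set} → (A → Bool) → List A → Bool
all? p = foldr (λ a r → p a ∧ r) true

independent : {n : ℕ} → Graph n → (Fin n → Bool) → Bool
independent {n} G S =
  all? (λ u → all? (λ v → not (S u ∧ S v ∧ adj G u v)) (allFin n)) (allFin n)

weight : {n : ℕ} → (Fin n → ℚ) → (Fin n → Bool) → ℚ
weight {n} x S = foldr (λ v r → (if S v then ℚ.- x v else 1ℚ) ℚ.* r) 1ℚ (allFin n)

Z : {n : ℕ} → Graph n → (Fin n → ℚ) → ℚ
Z {n} G x = foldr (λ S r → weight x S ℚ.+ r) 0ℚ (filter (λ S → Data.Bool._≟_ (independent G S) true) (subsets n))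

-- Maximality of ⟨G,h,g⟩ with ratio vector r = (g(v)/h(v))_v

MaximalRatio : {n : ℕ} → Graph n → (Fin n → ℚ) → Set
MaximalRatio {n} G r =
  Z G r ≡ 0ℚ ×
  (∀ (x : Fin n → ℚ) → (∀ v → 0ℚ ℚ.≤ x v × x v ℚ.≤ r v) →
     ¬ (∀ v → x v ≡ r v) → 0ℚ ℚ.< Z G x)

-- the game ⟨G,★k⟩ = ⟨G,★k,★1⟩ is maximal (ratio 1/k at every vertex)
MaximalConst : {n : ℕ} → Graph n → (k : ℕ) → .{{_ : NonZero k}} → Set
MaximalConst G k = MaximalRatio G (λ _ → (+ 1) / k)

Minimal : {n : ℕ} → Graph n → (h0 : ℕ) → .{{_ : NonZero h0}} → Set
Minimal G h0 =
  HGis G h0 ×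
  (∀ (S : ProperSubgraph G) → ∀ k → h0 ≤ k →
     ¬ Winning (ProperSubgraph.H S) (★ k)) ×
  MaximalConst G h0

data Walk {n : ℕ} (G : Graph n) : Fin n → Fin n → ℕ → Set where
  here : ∀ {u} → Walk G u u 0
  step : ∀ {u w v k} → adj G u w ≡ true → Walk G w v k → Walk G u v (suc k)

Diameter : {n : ℕ} → Graph n → ℕ → Set
Diameter {n} G d =
  (∀ u v → ∃[ k ] (k ≤ d × Walk G u v k)) ×
  (∃[ u ] ∃[ v ] (∀ k → k < d → ¬ Walk G u v k))

{-# OPTIONS --safe #-}
module Submission where

-- The graph is a chain of d cliques, consecutive ones sharing a vertex, with h = h0 = 2m.
-- Within a clique a shared vertex is given hatness 2 on one side and m on the other; the ratios of each clique then add up to 1, and the game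
-- is a product of clique games.  It is won by letting each clique guess the residue mod h of a weighted sum of its colours, a shared
-- vertex writing its colour as a pair of digits, one for each of its two cliques.
-- Building the chain vertex by vertex gives a recursion for the signed independence polynomial from which maximality follows.
-- By Shearer's form of the local lemma a maximal game becomes losing on every proper subgraph and for more colours: removing a vertex
-- sets a variable to 0, and Z(G - uv) = Z(G) + x_u x_v Z(G - N[u] - N[v]).

open import Defs
open import Data.Nat as ℕ using (ℕ; zero; suc; NonZero; z≤n; s≤s)
import Data.Nat.Properties as ℕP
open import Data.Nat.DivMod using (_%_; _/_; m≡m%n+[m/n]*n; m%n<n; m<n⇒m%n≡m; %-distribˡ-+; [m+kn]%n≡m%n; m∣n⇒o%n%m≡o%m; %-remove-+ˡ; m<n*o⇒m/o<n; m<n⇒m/n≡0)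
open import Data.Nat.Divisibility using (_∣_; divides; m∣m*n)
open import Data.Nat.Solver using () renaming (module +-*-Solver to ℕ-Solver)
import Data.Integer as ℤ
import Data.Integer.Properties as ℤP
open import Data.Rational as ℚ using (ℚ; 0ℚ; 1ℚ; _+_; _*_; -_; _-_; _≤_; _<_)
import Data.Rational.Properties as ℚP
import Data.Rational.Unnormalised as ℚᵘ
import Data.Rational.Unnormalised.Properties as ℚᵘP
open import Data.Rational.Solver using (module +-*-Solver)
open import Data.Fin using (Fin; zero; suc; _≟_; toℕ; fromℕ<)
open import Data.Fin.Properties using (any?; pigeonhole; <⇒≢; suc-injective; toℕ<n; toℕ-injective) renaming (all? to allFin?)
open import Data.Bool using (Bool; true; false; _∧_; _∨_; not; if_then_else_)
import Data.Bool
import Data.Bool.Properties as BoolP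
open import Data.List using (List; []; _∷_; filter; foldr; allFin; tabulate; concatMap)
open import Data.Vec using (Vec; []; _∷_; lookup; _[_]≔_)
open import Data.Vec.Properties using (lookup∘update; lookup∘update′)
open import Data.Product using (∃-syntax; _×_; _,_; proj₁; proj₂)
open import Data.Sum using (_⊎_; inj₁; inj₂)
open import Data.Empty using (⊥; ⊥-elim)
open import Function using (_∘_; id; mk⇔)
open import Relation.Nullary using (¬_; Dec; yes; no; does; contradiction)
open import Relation.Nullary.Decidable using (_×-dec_; _→-dec_; dec-true; dec-false)
open import Relation.Binary.PropositionalEquality using (_≡_; _≢_; refl; cong; cong₂; trans; subst; subst₂; _≗_; module ≡-Reasoning) renaming (sym to ≡-sym)
open import Algebra.Properties.CommutativeMonoid.Sum ℕP.+-0-commutativeMonoid using (sum; sum-cong-≗; ∑-distrib-+; ∑-comm)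

-- One number drives both halves of the argument. The index `p` of `Chain` is the ratio `p / h`
-- still free in the last clique, and it is also the number of residues mod `h` that the players
-- placed so far leave uncovered in the sum of that clique. `defect` and `guess-wins` are two
-- inductions along the same construction, so at `p = 0` the game is tight and won simultaneously.
-- Evenness of `h0` gives the factorisation of the ratio `1/h` of a shared vertex into `1/2` and
-- `1/m`. A clique entered with ratio `1/m = 2/h` has `(2m - 2)/h` left and must still offer
-- `m/h = 1/2` to the next shared vertex. Hence `m` has to be at least 2, which is the condition
-- `h0 > 3`.

private variable
  A B P Q R : Set
  h j k m n p p′ q : ℕ

-- The signed independence polynomial

bool-iff : {a b : Bool} → (a ≡ true → b ≡ true) → (b ≡ true → a ≡ true) → a ≡ b
bool-iff f g = BoolP.⇔→≡ (mk⇔ f g)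

∧-true : {a b : Bool} → a ≡ true → b ≡ true → a ∧ b ≡ true
∧-true refl refl = refl

foldr-tabulate : (c : A → B → B) (e : B) (f : Fin n → A) → foldr c e (tabulate f) ≡ foldr (c ∘ f) e (allFin n)
foldr-tabulate {n = zero}  c e f = refl
foldr-tabulate {n = suc n} c e f = cong (c (f zero))
  (trans (foldr-tabulate c e (f ∘ suc)) (≡-sym (foldr-tabulate (c ∘ f) e suc)))

foldr-suc : (c : Fin (suc n) → B → B) (e : B) → foldr c e (tabulate suc) ≡ foldr (c ∘ suc) e (allFin n)
foldr-suc c e = foldr-tabulate c e suc

allB : (Fin n → Bool) → Bool
allB {n} p = all? p (allFin n)

allB-suc : (p : Fin (suc n) → Bool) → allB p ≡ p zero ∧ allB (p ∘ suc)
allB-suc p = cong (p zero ∧_) (foldr-suc (λ a → p a ∧_) true)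

allB-elim : (p : Fin n → Bool) → allB p ≡ true → ∀ i → p i ≡ true
allB-elim p e zero    = BoolP.∧-conicalˡ (p zero) _ (trans (≡-sym (allB-suc p)) e)
allB-elim p e (suc i) = allB-elim (p ∘ suc) (BoolP.∧-conicalʳ (p zero) _ (trans (≡-sym (allB-suc p)) e)) i

allB-intro : (p : Fin n → Bool) → (∀ i → p i ≡ true) → allB p ≡ true
allB-intro {zero}  p h = refl
allB-intro {suc n} p h = trans (allB-suc p) (∧-true (h zero) (allB-intro (p ∘ suc) (h ∘ suc)))

allB-counterexample : (p : Fin n → Bool) → allB p ≡ false → ∃[ i ] p i ≡ false
allB-counterexample {suc n} p e with p zero in eq
... | false = zero , eq
... | true with allB-counterexample (p ∘ suc) (trans (≡-sym (foldr-suc (λ a → p a ∧_) true)) e)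
...   | i , q = suc i , q

tailG : Graph (suc n) → Graph n
tailG G = record
  { adj = λ u v → adj G (suc u) (suc v) ; sym = λ u v → sym G (suc u) (suc v) ; irrefl = λ v → irrefl G (suc v) }

-- A variable set to 0 stands for a deleted vertex, so that vertex deletions never leave `Fin n`.
mask : (Fin n → Bool) → (Fin n → ℚ) → Fin n → ℚ
mask B x u = if B u then 0ℚ else x u

sumL : (A → ℚ) → List A → ℚ
sumL f = foldr (λ a r → f a + r) 0ℚ

sumL-filter : (f : A → ℚ) (b : A → Bool) (l : List A) →
  sumL f (filter (λ a → b a Data.Bool.≟ true) l) ≡ sumL (λ a → if b a then f a else 0ℚ) l
sumL-filter f b []      = refl
sumL-filter f b (a ∷ l) with b a
... | true  = cong (f a +_) (sumL-filter f b l)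
... | false = trans (sumL-filter f b l) (≡-sym (ℚP.+-identityˡ _))

term : Graph n → (Fin n → ℚ) → (Fin n → Bool) → ℚ
term G x S = if independent G S then weight x S else 0ℚ

independent-elim : (G : Graph n) (S : Fin n → Bool) → independent G S ≡ true →
  ∀ u v → not (S u ∧ S v ∧ adj G u v) ≡ true
independent-elim G S e u v = allB-elim _ (allB-elim _ e u) v

independent-intro : (G : Graph n) (S : Fin n → Bool) →
  (∀ u v → not (S u ∧ S v ∧ adj G u v) ≡ true) → independent G S ≡ true
independent-intro G S h = allB-intro _ λ u → allB-intro _ (h u)

weight-suc : (x : Fin (suc n) → ℚ) (S : Fin (suc n) → Bool) →
  weight x S ≡ (if S zero then - x zero else 1ℚ) * weight (x ∘ suc) (S ∘ suc)
weight-suc x S = cong ((if S zero then - x zero else 1ℚ) *_) (foldr-suc (λ v → (if S v then - x v else 1ℚ) *_) 1ℚ)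

weight-cong : (x y : Fin n → ℚ) (S T : Fin n → Bool) → S ≗ T → (∀ v → S v ≡ true → x v ≡ y v) →
  weight x S ≡ weight y T
weight-cong {zero}  x y S T S≗T h = refl
weight-cong {suc n} x y S T S≗T h = begin
  weight x S                                                                ≡⟨ weight-suc x S ⟩
  (if S zero then - x zero else 1ℚ) * weight (x ∘ suc) (S ∘ suc)            ≡⟨ cong₂ _*_ head (weight-cong _ _ _ _ (S≗T ∘ suc) (h ∘ suc)) ⟩
  (if T zero then - y zero else 1ℚ) * weight (y ∘ suc) (T ∘ suc)            ≡⟨ weight-suc y T ⟨
  weight y T                                                                ∎
  where
  open ≡-Reasoning
  head : (if S zero then - x zero else 1ℚ) ≡ (if T zero then - y zero else 1ℚ)
  head with S zero in e | T zero | S≗T zero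
  ... | true  | .true  | refl = cong -_ (h zero e)
  ... | false | .false | refl = refl

weight-zero : (x : Fin n → ℚ) (S : Fin n → Bool) (v : Fin n) → S v ≡ true → x v ≡ 0ℚ → weight x S ≡ 0ℚ
weight-zero x S zero    s e = trans (weight-suc x S)
  (trans (cong (_* weight (x ∘ suc) (S ∘ suc)) (trans (cong (λ b → if b then - x zero else 1ℚ) s) (cong -_ e))) (ℚP.*-zeroˡ (weight (x ∘ suc) (S ∘ suc))))
weight-zero x S (suc v) s e = trans (weight-suc x S)
  (trans (cong ((if S zero then - x zero else 1ℚ) *_) (weight-zero (x ∘ suc) (S ∘ suc) v s e)) (ℚP.*-zeroʳ (if S zero then - x zero else 1ℚ)))

module _ (G : Graph (suc n)) (x : Fin (suc n) → ℚ) (s : Fin n → Bool) (S : Fin (suc n) → Bool) (S-suc : ∀ i → S (suc i) ≡ s i) where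

  private
    nbr : Fin n → Bool
    nbr u = adj G zero (suc u)

    tail-⇒ : independent G S ≡ true → independent (tailG G) s ≡ true
    tail-⇒ e = independent-intro (tailG G) s λ u v →
      subst (λ b → not (b ∧ s v ∧ adj G (suc u) (suc v)) ≡ true) (S-suc u)
        (subst (λ b → not (S (suc u) ∧ b ∧ adj G (suc u) (suc v)) ≡ true) (S-suc v)
          (independent-elim G S e (suc u) (suc v)))

    inner : independent (tailG G) s ≡ true → ∀ u v → not (S (suc u) ∧ S (suc v) ∧ adj G (suc u) (suc v)) ≡ true
    inner e u v rewrite S-suc u | S-suc v = independent-elim (tailG G) s e u v

  term-without : S zero ≡ false → term G x S ≡ term (tailG G) (x ∘ suc) s
  term-without S0 = cong₂ (λ b w → if b then w else 0ℚ) (bool-iff tail-⇒ back)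
    (trans (weight-suc x S) (trans (cong (λ b → (if b then - x zero else 1ℚ) * weight (x ∘ suc) (S ∘ suc)) S0)
      (trans (ℚP.*-identityˡ _) (weight-cong _ _ _ _ S-suc λ _ _ → refl))))
    where
    absorb : ∀ b → not (b ∧ false) ≡ true
    absorb true  = refl
    absorb false = refl
    clause : independent (tailG G) s ≡ true → ∀ u v → not (S u ∧ S v ∧ adj G u v) ≡ true
    clause e zero    v       = cong (λ b → not (b ∧ S v ∧ adj G zero v)) S0
    clause e (suc u) zero    = trans (cong (λ b → not (S (suc u) ∧ b ∧ adj G (suc u) zero)) S0) (absorb (S (suc u)))
    clause e (suc u) (suc v) = inner e u v
    back : independent (tailG G) s ≡ true → independent G S ≡ true
    back e = independent-intro G S (clause e)

  private
    free : Bool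
    free = allB (λ v → not (s v ∧ nbr v))

    independent-with : S zero ≡ true → independent G S ≡ independent (tailG G) s ∧ free
    independent-with S0 = bool-iff
      (λ e → ∧-true (tail-⇒ e) (allB-intro _ λ v →
        subst (λ b → not (b ∧ nbr v) ≡ true) (S-suc v)
          (subst (λ b → not (b ∧ S (suc v) ∧ nbr v) ≡ true) S0 (independent-elim G S e zero (suc v)))))
      (λ e → independent-intro G S (back e))
      where
      edge : independent (tailG G) s ∧ free ≡ true → ∀ v → not (S (suc v) ∧ nbr v) ≡ true
      edge e v = trans (cong (λ b → not (b ∧ nbr v)) (S-suc v)) (allB-elim _ (BoolP.∧-conicalʳ (independent (tailG G) s) _ e) v)
      back : independent (tailG G) s ∧ free ≡ true → ∀ u v → not (S u ∧ S v ∧ adj G u v) ≡ true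
      back e zero    zero    rewrite S0 | irrefl G zero = refl
      back e zero    (suc v) rewrite S0 = edge e v
      back e (suc u) zero    rewrite S0 | sym G (suc u) zero = edge e u
      back e (suc u) (suc v) = inner (BoolP.∧-conicalˡ (independent (tailG G) s) _ e) u v

  -- A set containing `zero` is independent iff its tail is independent and avoids the neighbours of
  -- `zero`. A tail that meets a neighbour gets weight 0 after masking, so the mask takes over the
  -- test `free`.
  term-with : S zero ≡ true → term G x S ≡ - x zero * term (tailG G) (mask nbr (x ∘ suc)) s
  term-with S0 = trans (cong₂ (λ b w → if b then w else 0ℚ) (independent-with S0)
    (trans (weight-suc x S) (cong₂ (λ b w → (if b then - x zero else 1ℚ) * w) S0 (weight-cong _ _ _ _ S-suc λ _ _ → refl))))
    (split (independent (tailG G) s) free refl)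
    where
    split : ∀ i f → f ≡ free →
      (if i ∧ f then - x zero * weight (x ∘ suc) s else 0ℚ) ≡ - x zero * (if i then weight (mask nbr (x ∘ suc)) s else 0ℚ)
    split false f     _ = ≡-sym (ℚP.*-zeroʳ (- x zero))
    split true  true  e = cong (- x zero *_) (weight-cong _ _ _ _ (λ _ → refl) λ v sv → unmasked v sv (allB-elim _ (≡-sym e) v))
      where
      unmasked : ∀ v → s v ≡ true → not (s v ∧ nbr v) ≡ true → x (suc v) ≡ mask nbr (x ∘ suc) v
      unmasked v sv h with nbr v
      ... | false = refl
      ... | true rewrite sv with () ← h
    split true  false e with v , h ← allB-counterexample _ (≡-sym e) =
      ≡-sym (trans (cong (- x zero *_) (weight-zero _ s v (proj₁ (both v h)) (cong (λ b → if b then 0ℚ else x (suc v)) (proj₂ (both v h))))) (ℚP.*-zeroʳ (- x zero)))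
      where
      both : ∀ v → not (s v ∧ nbr v) ≡ false → s v ≡ true × nbr v ≡ true
      both v h with s v | nbr v
      ... | true | true = refl , refl

-- The independent sets are split by membership of `zero`.
Z-suc : (G : Graph (suc n)) (x : Fin (suc n) → ℚ) →
  Z G x ≡ Z (tailG G) (x ∘ suc) - x zero * Z (tailG G) (mask (λ u → adj G zero (suc u)) (x ∘ suc))
Z-suc {n} G x = begin
  Z G x
    ≡⟨ sumL-filter (weight x) (independent G) (subsets (suc n)) ⟩
  sumL (term G x) (subsets (suc n))
    ≡⟨ pairs _ _ (λ _ → refl) (λ _ _ → refl) (λ _ → refl) (λ _ _ → refl) (subsets n) ⟩
  sumL (term T y) (subsets n) - x zero * sumL (term T z) (subsets n)
    ≡⟨ cong₂ (λ a b → a - x zero * b) (sumL-filter (weight y) (independent T) (subsets n)) (sumL-filter (weight z) (independent T) (subsets n)) ⟨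
  Z T y - x zero * Z T z
    ∎
  where
  open ≡-Reasoning
  T : Graph n
  T = tailG G
  y z : Fin n → ℚ
  y = x ∘ suc
  z = mask (λ u → adj G zero (suc u)) y
  arrange : ∀ a p b c d → a + (- p * b + (c - p * d)) ≡ (a + c) - p * (b + d)
  arrange = solve 5 (λ a p b c d → a :+ (:- p :* b :+ (c :- p :* d)) := (a :+ c) :- p :* (b :+ d)) refl
    where open +-*-Solver
  -- The two extensions made by `subsets` are local to its definition, so they enter through their
  -- values alone.
  pairs : (e₀ e₁ : (Fin n → Bool) → Fin (suc n) → Bool) →
    (∀ s → e₀ s zero ≡ false) → (∀ s i → e₀ s (suc i) ≡ s i) → (∀ s → e₁ s zero ≡ true) → (∀ s i → e₁ s (suc i) ≡ s i) →
    ∀ l → sumL (term G x) (concatMap (λ s → e₀ s ∷ e₁ s ∷ []) l) ≡ sumL (term T y) l - x zero * sumL (term T z) l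
  pairs e₀ e₁ z₀ s₀ z₁ s₁ []      = ≡-sym (trans (cong (λ t → 0ℚ - t) (ℚP.*-zeroʳ (x zero))) refl)
  pairs e₀ e₁ z₀ s₀ z₁ s₁ (s ∷ l) = trans
    (cong₂ _+_ (term-without G x s (e₀ s) (s₀ s) (z₀ s))
      (cong₂ _+_ (term-with G x s (e₁ s) (s₁ s) (z₁ s)) (pairs e₀ e₁ z₀ s₀ z₁ s₁ l)))
    (arrange (term T y s) (x zero) (term T z s) (sumL (term T y) l) (sumL (term T z) l))

mask-swap : (B C : Fin n → Bool) (x : Fin n → ℚ) → mask B (mask C x) ≗ mask C (mask B x)
mask-swap B C x u with B u | C u
... | true  | true  = refl
... | true  | false = refl
... | false | true  = refl
... | false | false = refl

mask-≢0 : (B : Fin n → Bool) (x : Fin n → ℚ) (u : Fin n) → mask B x u ≢ 0ℚ → x u ≢ 0ℚ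
mask-≢0 B x u h with B u
... | true  = λ _ → h refl
... | false = h

-- A set through a vertex of variable 0 has weight 0, so only edges between the remaining vertices
-- matter. This serves as extensionality for `Z` and also allows an edge to be removed or restored
-- once one of its ends is masked.
Z-agree : (G G′ : Graph n) (x y : Fin n → ℚ) → x ≗ y →
  (∀ u v → x u ≢ 0ℚ → x v ≢ 0ℚ → adj G u v ≡ adj G′ u v) → Z G x ≡ Z G′ y
Z-agree {zero}  G G′ x y x≗y h = refl
Z-agree {suc n} G G′ x y x≗y h = trans (Z-suc G x) (trans
  (cong₂ _-_ (Z-agree (tailG G) (tailG G′) (x ∘ suc) (y ∘ suc) (x≗y ∘ suc) λ u v → h (suc u) (suc v)) head)
  (≡-sym (Z-suc G′ y)))
  where
  N N′ : Fin n → Bool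
  N u = adj G zero (suc u)
  N′ u = adj G′ zero (suc u)
  zero* : ∀ {a b} → a ≡ 0ℚ → a * b ≡ 0ℚ
  zero* {b = b} refl = ℚP.*-zeroˡ b
  head : x zero * Z (tailG G) (mask N (x ∘ suc)) ≡ y zero * Z (tailG G′) (mask N′ (y ∘ suc))
  -- If `x zero` is 0 the two neighbourhoods of `zero` may differ, but both terms carry the factor
  -- 0.
  head with x zero ℚP.≟ 0ℚ
  ... | yes x₀≡0 = trans (zero* x₀≡0) (≡-sym (zero* (trans (≡-sym (x≗y zero)) x₀≡0)))
  ... | no  x₀≢0 = cong₂ _*_ (x≗y zero) (Z-agree (tailG G) (tailG G′) _ _ masks
          λ u v hu hv → h (suc u) (suc v) (mask-≢0 N (x ∘ suc) u hu) (mask-≢0 N (x ∘ suc) v hv))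
    where
    if-same : ∀ b → (if b then 0ℚ else 0ℚ) ≡ 0ℚ
    if-same true  = refl
    if-same false = refl
    masks : mask N (x ∘ suc) ≗ mask N′ (y ∘ suc)
    masks u with x (suc u) ℚP.≟ 0ℚ
    ... | yes e rewrite ≡-sym (x≗y (suc u)) | e = trans (if-same (N u)) (≡-sym (if-same (N′ u)))
    ... | no  ¬e = cong₂ (λ b t → if b then 0ℚ else t) (h zero (suc u) x₀≢0 ¬e) (x≗y (suc u))

Z-cong : (G : Graph n) {x y : Fin n → ℚ} → x ≗ y → Z G x ≡ Z G y
Z-cong G x≗y = Z-agree G G _ _ x≗y λ _ _ _ _ → refl

isᵇ : Fin n → Fin n → Bool
isᵇ v u = does (u ≟ v)

closedNbhd : Graph n → Fin n → Fin n → Bool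
closedNbhd G v u = isᵇ v u ∨ adj G v u

-- Expanding at `zero` and then at `v` gives the same as the opposite order: the mixed term occurs
-- exactly when the two are non-adjacent, a symmetric condition.
Z-at : (G : Graph n) (x : Fin n → ℚ) (v : Fin n) →
  Z G x ≡ Z G (mask (isᵇ v) x) - x v * Z G (mask (closedNbhd G v) x)
Z-at {suc n} G x zero = trans (Z-suc G x) (≡-sym (trans
  (cong₂ (λ a b → a - x zero * b) (Z-suc G (mask (isᵇ zero) x)) (Z-suc G (mask (closedNbhd G zero) x)))
  (drop (Z (tailG G) (x ∘ suc)) (Z (tailG G) (mask N (x ∘ suc))) (x zero)
    (Z (tailG G) (mask N (mask (isᵇ zero) x ∘ suc))) (Z (tailG G) (mask N (mask (closedNbhd G zero) x ∘ suc))))))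
  where
  N : Fin n → Bool
  N u = adj G zero (suc u)
  drop : ∀ a b x c d → (a - 0ℚ * c) - x * (b - 0ℚ * d) ≡ a - x * b
  drop = solve 5 (λ a b x c d → (a :- con 0ℚ :* c) :- x :* (b :- con 0ℚ :* d) := a :- x :* b) refl
    where open +-*-Solver
Z-at {suc n} G x (suc w) = begin
  Z G x
    ≡⟨ Z-suc G x ⟩
  Z T y - x zero * Z T (mask N y)
    ≡⟨ cong₂ (λ a b → a - x zero * b) (Z-at T y w) (Z-at T (mask N y) w) ⟩
  (a - y w * c) - x zero * (Z T (mask (isᵇ w) (mask N y)) - mask N y w * Z T (mask (closedNbhd T w) (mask N y)))
    ≡⟨ cong₂ (λ s t → (a - y w * c) - x zero * (s - mask N y w * t))
         (Z-cong T (mask-swap (isᵇ w) N y)) (Z-cong T (mask-swap (closedNbhd T w) N y)) ⟩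
  (a - y w * c) - x zero * (d - mask N y w * e)
    ≡⟨ swap (N w) a (y w) c (x zero) d e ⟩
  (a - x zero * d) - y w * (c - (if N w then 0ℚ else x zero) * e)
    ≡⟨ cong (λ b → (a - x zero * d) - y w * (c - (if b then 0ℚ else x zero) * e)) (sym G zero (suc w)) ⟩
  (a - x zero * d) - y w * (c - (if adj G (suc w) zero then 0ℚ else x zero) * e)
    ≡⟨ cong₂ (λ s t → s - y w * t) (Z-suc G (mask (isᵇ (suc w)) x)) (Z-suc G (mask (closedNbhd G (suc w)) x)) ⟨
  Z G (mask (isᵇ (suc w)) x) - x (suc w) * Z G (mask (closedNbhd G (suc w)) x) ∎
  where
  open ≡-Reasoning
  T : Graph n
  T = tailG G
  y : Fin n → ℚ
  y = x ∘ suc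
  N : Fin n → Bool
  N u = adj G zero (suc u)
  a c d e : ℚ
  a = Z T (mask (isᵇ w) y)
  c = Z T (mask (closedNbhd T w) y)
  d = Z T (mask N (mask (isᵇ w) y))
  e = Z T (mask N (mask (closedNbhd T w) y))
  swap : ∀ b a t c p d e → (a - t * c) - p * (d - (if b then 0ℚ else t) * e) ≡ (a - p * d) - t * (c - (if b then 0ℚ else p) * e)
  swap true  = solve 6 (λ a t c p d e → (a :- t :* c) :- p :* (d :- con 0ℚ :* e) := (a :- p :* d) :- t :* (c :- con 0ℚ :* e)) refl
    where open +-*-Solver
  swap false = solve 6 (λ a t c p d e → (a :- t :* c) :- p :* (d :- t :* e) := (a :- p :* d) :- t :* (c :- p :* e)) refl
    where open +-*-Solver

-- Ordered-field arithmetic and reciprocals in ℚ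

≤⇒0≤- : ∀ {p q} → p ≤ q → 0ℚ ≤ q - p
≤⇒0≤- {p} {q} h = subst (_≤ q - p) (ℚP.+-inverseʳ p) (ℚP.+-monoˡ-≤ (- p) h)

0≤-⇒≤ : ∀ {p q} → 0ℚ ≤ q - p → p ≤ q
0≤-⇒≤ {p} {q} h = subst₂ _≤_ (ℚP.+-identityˡ p) (cancel q p) (ℚP.+-monoˡ-≤ p h)
  where
  cancel : ∀ q p → q - p + p ≡ q
  cancel = solve 2 (λ q p → q :- p :+ p := q) refl
    where open +-*-Solver

<⇒0<- : ∀ {p q} → p < q → 0ℚ < q - p
<⇒0<- {p} {q} h = subst (_< q - p) (ℚP.+-inverseʳ p) (ℚP.+-monoˡ-< (- p) h)

≤∧≢⇒< : ∀ {p q} → p ≤ q → p ≢ q → p < q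
≤∧≢⇒< {p} {q} p≤q p≢q = ℚP.≰⇒> λ q≤p → p≢q (ℚP.≤-antisym p≤q q≤p)

0≤-+ : ∀ {p q} → 0ℚ ≤ p → 0ℚ ≤ q → 0ℚ ≤ p + q
0≤-+ hp hq = ℚP.+-mono-≤ hp hq

0<-+-0≤ : ∀ {p q} → 0ℚ < p → 0ℚ ≤ q → 0ℚ < p + q
0<-+-0≤ hp hq = ℚP.+-mono-<-≤ hp hq

0≤-+-0< : ∀ {p q} → 0ℚ ≤ p → 0ℚ < q → 0ℚ < p + q
0≤-+-0< hp hq = ℚP.+-mono-≤-< hp hq

0≤-* : ∀ {p q} → 0ℚ ≤ p → 0ℚ ≤ q → 0ℚ ≤ p * q
0≤-* {p} {q} hp hq = subst (_≤ p * q) (ℚP.*-zeroʳ p) (ℚP.*-monoˡ-≤-nonNeg p {{ℚ.nonNegative hp}} hq)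

0<-* : ∀ {p q} → 0ℚ < p → 0ℚ < q → 0ℚ < p * q
0<-* {p} {q} hp hq = subst (_< p * q) (ℚP.*-zeroʳ p) (ℚP.*-monoʳ-<-pos p {{ℚ.positive hp}} hq)

0≤-cancel-* : ∀ {p q} → 0ℚ < p → 0ℚ ≤ p * q → 0ℚ ≤ q
0≤-cancel-* {p} {q} hp h = ℚP.*-cancelˡ-≤-pos p {{ℚ.positive hp}} (subst (_≤ p * q) (≡-sym (ℚP.*-zeroʳ p)) h)

-- The recursive form suits induction and the ring solver; `ι≡` and `ι*recip` connect it with
-- normalised fractions.
ι : ℕ → ℚ
ι zero    = 0ℚ
ι (suc n) = 1ℚ + ι n

ι-+ : ∀ a b → ι (a ℕ.+ b) ≡ ι a + ι b
ι-+ zero    b = ≡-sym (ℚP.+-identityˡ (ι b))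
ι-+ (suc a) b = trans (cong (1ℚ +_) (ι-+ a b)) (≡-sym (ℚP.+-assoc 1ℚ (ι a) (ι b)))

ι-* : ∀ a b → ι (a ℕ.* b) ≡ ι a * ι b
ι-* zero    b = ≡-sym (ℚP.*-zeroˡ (ι b))
ι-* (suc a) b = trans (ι-+ b (a ℕ.* b)) (trans (cong (ι b +_) (ι-* a b)) (expand (ι a) (ι b)))
  where
  expand : ∀ a b → b + a * b ≡ (1ℚ + a) * b
  expand = solve 2 (λ a b → b :+ a :* b := (con 1ℚ :+ a) :* b) refl
    where open +-*-Solver

0≤ι : ∀ n → 0ℚ ≤ ι n
0≤ι zero    = ℚP.≤-refl
0≤ι (suc n) = 0≤-+ (ℚP.<⇒≤ (ℚP.positive⁻¹ 1ℚ)) (0≤ι n)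

0<ι : ∀ n → 0ℚ < ι (suc n)
0<ι n = 0<-+-0≤ (ℚP.positive⁻¹ 1ℚ) (0≤ι n)

ι-mono : ∀ {a b} → a ℕ.≤ b → ι a ≤ ι b
ι-mono {b = b} z≤n = 0≤ι b
ι-mono (s≤s h) = ℚP.+-monoʳ-≤ 1ℚ (ι-mono h)

ι-mono-< : ∀ {a b} → a ℕ.< b → ι a < ι b
ι-mono-< {a} h = ℚP.<-≤-trans (subst (_< 1ℚ + ι a) (ℚP.+-identityˡ (ι a)) (ℚP.+-monoˡ-< (ι a) (ℚP.positive⁻¹ 1ℚ))) (ι-mono h)

recip : (k : ℕ) .{{_ : NonZero k}} → ℚ
recip k = (ℤ.+ 1) ℚ./ k

ι≡ : ∀ n → ι n ≡ (ℤ.+ n) ℚ./ 1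
ι≡ zero    = refl
ι≡ (suc n) = trans (cong (1ℚ +_) (ι≡ n)) (ℚP.toℚᵘ-injective (begin
  ℚ.toℚᵘ (1ℚ + (ℤ.+ n) ℚ./ 1)               ≈⟨ ℚP.toℚᵘ-homo-+ 1ℚ ((ℤ.+ n) ℚ./ 1) ⟩
  ℚ.toℚᵘ 1ℚ ℚᵘ.+ ℚ.toℚᵘ ((ℤ.+ n) ℚ./ 1)      ≈⟨ ℚᵘP.+-congʳ (ℚ.toℚᵘ 1ℚ) (ℚP.toℚᵘ-fromℚᵘ (ℚᵘ.mkℚᵘ (ℤ.+ n) 0)) ⟩
  ℚ.toℚᵘ 1ℚ ℚᵘ.+ ℚᵘ.mkℚᵘ (ℤ.+ n) 0           ≈⟨ ℚᵘ.*≡* (cong (λ t → (ℤ.+ 1 ℤ.+ t) ℤ.* ℤ.+ 1) (ℤP.*-identityʳ (ℤ.+ n))) ⟩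
  ℚᵘ.mkℚᵘ (ℤ.+ suc n) 0                      ≈⟨ ℚP.toℚᵘ-fromℚᵘ (ℚᵘ.mkℚᵘ (ℤ.+ suc n) 0) ⟨
  ℚ.toℚᵘ ((ℤ.+ suc n) ℚ./ 1)                 ∎))
  where open import Relation.Binary.Reasoning.Setoid ℚᵘP.≃-setoid

ι*recip : (k : ℕ) .{{_ : NonZero k}} → ι k * recip k ≡ 1ℚ
ι*recip (suc k) = trans (cong (_* recip (suc k)) (ι≡ (suc k))) (ℚP.toℚᵘ-injective (begin
  ℚ.toℚᵘ (((ℤ.+ suc k) ℚ./ 1) * recip (suc k))             ≈⟨ ℚP.toℚᵘ-homo-* ((ℤ.+ suc k) ℚ./ 1) ((ℤ.+ 1) ℚ./ suc k) ⟩
  ℚ.toℚᵘ ((ℤ.+ suc k) ℚ./ 1) ℚᵘ.* ℚ.toℚᵘ ((ℤ.+ 1) ℚ./ suc k) ≈⟨ ℚᵘP.*-cong (ℚP.toℚᵘ-fromℚᵘ (ℚᵘ.mkℚᵘ (ℤ.+ suc k) 0)) (ℚP.toℚᵘ-fromℚᵘ (ℚᵘ.mkℚᵘ (ℤ.+ 1) k)) ⟩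
  ℚᵘ.mkℚᵘ (ℤ.+ suc k) 0 ℚᵘ.* ℚᵘ.mkℚᵘ (ℤ.+ 1) k               ≈⟨ ℚᵘ.*≡* (cong ℤ.+_ (trans (ℕP.*-identityʳ (suc k ℕ.* 1)) (trans (ℕP.*-comm (suc k) 1) (≡-sym (ℕP.*-identityˡ (1 ℕ.* suc k)))))) ⟩
  ℚ.toℚᵘ 1ℚ                                                  ∎))
  where open import Relation.Binary.Reasoning.Setoid ℚᵘP.≃-setoid

0<recip : (k : ℕ) .{{_ : NonZero k}} → 0ℚ < recip k
0<recip (suc k) = ℚP.positive⁻¹ (recip (suc k)) {{ℚP.normalize-pos 1 (suc k)}}

recip-difference : (h k : ℕ) .{{_ : NonZero h}} .{{_ : NonZero k}} →
  recip h * recip k * (ι k - ι h) ≡ recip h - recip k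
recip-difference h k = trans (arrange (recip h) (recip k) (ι h) (ι k))
  (trans (cong₂ (λ a b → recip h * a - recip k * b) (ι*recip k) (ι*recip h))
    (cong₂ _-_ (ℚP.*-identityʳ (recip h)) (ℚP.*-identityʳ (recip k))))
  where
  arrange : ∀ a b c d → a * b * (d - c) ≡ a * (d * b) - b * (c * a)
  arrange = solve 4 (λ a b c d → a :* b :* (d :- c) := a :* (d :* b) :- b :* (c :* a)) refl
    where open +-*-Solver

recip-anti : {h k : ℕ} .{{_ : NonZero h}} .{{_ : NonZero k}} → h ℕ.≤ k → recip k ≤ recip h
recip-anti {h} {k} h≤k = 0≤-⇒≤ (subst (0ℚ ≤_) (recip-difference h k)
  (0≤-* (0≤-* (ℚP.<⇒≤ (0<recip h)) (ℚP.<⇒≤ (0<recip k))) (≤⇒0≤- (ι-mono h≤k))))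

recip-≢ : {h k : ℕ} .{{_ : NonZero h}} .{{_ : NonZero k}} → h ℕ.< k → recip k ≢ recip h
recip-≢ {h} {k} h<k e = ℚP.<⇒≢ (0<-* (0<-* (0<recip h) (0<recip k)) (<⇒0<- (ι-mono-< h<k)))
  (≡-sym (trans (recip-difference h k) (trans (cong (λ t → recip h - t) e) (ℚP.+-inverseʳ (recip h)))))

-- Shearer's bound

⟦_⟧ : Dec P → ℕ
⟦ P? ⟧ = if does P? then 1 else 0

⟦⟧-mono : (P? : Dec P) (Q? : Dec Q) → (P → Q) → ⟦ P? ⟧ ℕ.≤ ⟦ Q? ⟧
⟦⟧-mono (yes p) (yes q) f = ℕP.≤-refl
⟦⟧-mono (yes p) (no ¬q) f = contradiction (f p) ¬q
⟦⟧-mono (no ¬p) Q?      f = z≤n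

⟦⟧-≤-+ : (P? : Dec P) (Q? : Dec Q) (R? : Dec R) → (P → Q ⊎ R) → ⟦ P? ⟧ ℕ.≤ ⟦ Q? ⟧ ℕ.+ ⟦ R? ⟧
⟦⟧-≤-+ (no ¬p) Q? R? f = z≤n
⟦⟧-≤-+ (yes p) Q? R? f with f p
⟦⟧-≤-+ (yes p) (yes _) R?      f | inj₁ q = s≤s z≤n
⟦⟧-≤-+ (yes p) (no ¬q) R?      f | inj₁ q = contradiction q ¬q
⟦⟧-≤-+ (yes p) Q?      (yes _) f | inj₂ r = ℕP.m≤n+m 1 ⟦ Q? ⟧
⟦⟧-≤-+ (yes p) Q?      (no ¬r) f | inj₂ r = contradiction r ¬r

⟦⟧-yes : (P? : Dec P) → P → 0 ℕ.< ⟦ P? ⟧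
⟦⟧-yes (yes _) p = s≤s z≤n
⟦⟧-yes (no ¬p) p = contradiction p ¬p

⟦⟧-holds : (P? : Dec P) → 0 ℕ.< ⟦ P? ⟧ → P
⟦⟧-holds (yes p) _ = p

sum-mono : (f g : Fin n → ℕ) → (∀ i → f i ℕ.≤ g i) → sum f ℕ.≤ sum g
sum-mono {zero}  f g h = z≤n
sum-mono {suc n} f g h = ℕP.+-mono-≤ (h zero) (sum-mono (f ∘ suc) (g ∘ suc) (h ∘ suc))

sum-const : ∀ n m → sum {n} (λ _ → m) ≡ n ℕ.* m
sum-const zero    m = refl
sum-const (suc n) m = cong (m ℕ.+_) (sum-const n m)

sum-*ˡ : ∀ m (f : Fin n → ℕ) → m ℕ.* sum f ≡ sum (λ i → m ℕ.* f i)
sum-*ˡ {zero}  m f = ℕP.*-zeroʳ m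
sum-*ˡ {suc n} m f = trans (ℕP.*-distribˡ-+ m (f zero) _) (cong (m ℕ.* f zero ℕ.+_) (sum-*ˡ m (f ∘ suc)))

sum-witness : (f : Fin n → ℕ) → 0 ℕ.< sum f → ∃[ i ] 0 ℕ.< f i
sum-witness {suc n} f h with f zero in e
... | suc m = zero , subst (0 ℕ.<_) (≡-sym e) (s≤s z≤n)
... | zero with sum-witness (f ∘ suc) h
...   | i , p = suc i , p

-- The counting form of "conditional probability at most `1/k`": applied to the colours of one
-- vertex, of which at most one triggers its event.
sum-unique : {P : Fin n → Set} (P? : ∀ i → Dec (P i)) (Q? : Dec Q) →
  (∀ i j → P i → P j → i ≡ j) → (∀ i → P i → Q) → sum (λ i → ⟦ P? i ⟧) ℕ.≤ ⟦ Q? ⟧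
sum-unique {zero}  P? Q? unique f = z≤n
sum-unique {suc n} P? Q? unique f with P? zero
... | no  _ = sum-unique (P? ∘ suc) Q? (λ i j p q → suc-injective (unique (suc i) (suc j) p q)) (f ∘ suc)
... | yes p = ℕP.≤-trans (s≤s (ℕP.≤-trans (sum-mono _ (λ _ → 0) none) (ℕP.≤-reflexive (trans (sum-const n 0) (ℕP.*-zeroʳ n))))) (⟦⟧-yes Q? (f zero p))
  where
  none : ∀ i → ⟦ P? (suc i) ⟧ ℕ.≤ 0
  none i with P? (suc i)
  ... | no  _ = z≤n
  ... | yes q with () ← unique zero (suc i) p q

-- Counting colourings

total : ∀ n → (Vec (Fin k) n → ℕ) → ℕ
total zero    F = F []
total (suc n) F = sum (λ a → total n (λ c → F (a ∷ c)))

total-mono : ∀ n {F G : Vec (Fin k) n → ℕ} → (∀ c → F c ℕ.≤ G c) → total n F ℕ.≤ total n G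
total-mono zero    h = h []
total-mono (suc n) h = sum-mono _ _ λ a → total-mono n λ c → h (a ∷ c)

total-+ : ∀ n (F G : Vec (Fin k) n → ℕ) → total n (λ c → F c ℕ.+ G c) ≡ total n F ℕ.+ total n G
total-+ zero    F G = refl
total-+ (suc n) F G = trans (sum-cong-≗ λ a → total-+ n (λ c → F (a ∷ c)) (λ c → G (a ∷ c))) (∑-distrib-+ (λ a → total n (λ c → F (a ∷ c))) (λ a → total n (λ c → G (a ∷ c))))

total-sum : ∀ n {m} (F : Fin m → Vec (Fin k) n → ℕ) → total n (λ c → sum (λ a → F a c)) ≡ sum (λ a → total n (F a))
total-sum zero    F = refl
total-sum (suc n) F = trans (sum-cong-≗ λ b → total-sum n (λ a c → F a (b ∷ c))) (∑-comm λ b a → total n (λ c → F a (b ∷ c)))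

-- Resampling coordinate `v` in all colourings produces each colouring `k` times, once for every
-- former colour of `v`.
total-resample : ∀ {n} (v : Fin n) (F : Vec (Fin k) n → ℕ) → k ℕ.* total n F ≡ total n (λ c → sum (λ a → F (c [ v ]≔ a)))
total-resample {k} {suc n} zero F = trans (cong (k ℕ.*_) (≡-sym (total-sum n (λ a c → F (a ∷ c))))) (≡-sym (sum-const k _))
total-resample {k} {suc n} (suc v) F = trans (sum-*ˡ k (λ b → total n (λ c → F (b ∷ c)))) (sum-cong-≗ λ b → total-resample v (λ c → F (b ∷ c)))

total-witness : ∀ n (F : Vec (Fin k) n → ℕ) → 0 ℕ.< total n F → ∃[ c ] 0 ℕ.< F c
total-witness zero    F h = [] , h
total-witness (suc n) F h with sum-witness _ h
... | a , h′ with total-witness n _ h′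
...   | c , p = a ∷ c , p

total-positive : ∀ n (F : Vec (Fin (suc k)) n → ℕ) → (∀ c → 0 ℕ.< F c) → 0 ℕ.< total n F
total-positive zero    F h = h []
total-positive (suc n) F h = ℕP.≤-trans (total-positive n _ λ c → h (zero ∷ c)) (ℕP.m≤m+n _ _)

infixl 6 _∖_

_∖_ : (Fin n → Bool) → (Fin n → Bool) → Fin n → Bool
(S ∖ B) u = S u ∧ not (B u)

infix 4 _⊆_

_⊆_ : (Fin n → Bool) → (Fin n → Bool) → Set
S ⊆ T = ∀ v → S v ≡ true → T v ≡ true

∖-⊆ : (S B : Fin n → Bool) → S ∖ B ⊆ S
∖-⊆ S B v = BoolP.∧-conicalˡ (S v) _

not-true : ∀ {b} → not b ≡ true → b ≡ false
not-true {false} _ = refl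

not-false : ∀ {b} → b ≡ false → not b ≡ true
not-false refl = refl

isᵇ-refl : (v : Fin n) → isᵇ v v ≡ true
isᵇ-refl v = dec-true (v ≟ v) refl

isᵇ-≢ : {u v : Fin n} → u ≢ v → isᵇ v u ≡ false
isᵇ-≢ {u = u} {v} = dec-false (u ≟ v)

∉-isᵇ : {u v : Fin n} → isᵇ v u ≡ false → u ≢ v
∉-isᵇ {u = u} e refl with () ← trans (≡-sym (isᵇ-refl u)) e

size : (Fin n → Bool) → ℕ
size {zero}  S = 0
size {suc n} S = (if S zero then 1 else 0) ℕ.+ size (S ∘ suc)

size-cong : {S T : Fin n → Bool} → S ≗ T → size S ≡ size T
size-cong {zero}  h = refl
size-cong {suc n} h = cong₂ (λ b m → (if b then 1 else 0) ℕ.+ m) (h zero) (size-cong (h ∘ suc))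

size-∖ : (S : Fin n → Bool) (v : Fin n) → S v ≡ true → size S ≡ suc (size (S ∖ isᵇ v))
size-∖ S zero    h rewrite h = cong suc (size-cong λ u → ≡-sym (BoolP.∧-identityʳ (S (suc u))))
size-∖ S (suc v) h = trans (cong ((if S zero then 1 else 0) ℕ.+_) (size-∖ (S ∘ suc) v h))
  (trans (ℕP.+-suc (if S zero then 1 else 0) _)
    (cong (λ b → suc ((if b then 1 else 0) ℕ.+ size ((S ∘ suc) ∖ isᵇ v))) (≡-sym (BoolP.∧-identityʳ (S zero)))))

-- The lopsided form of the local lemma. Events at non-adjacent vertices may share colours and be
-- dependent, but resampling the colour of `v` leaves the events outside N[v] unchanged (`local`)
-- and triggers `E v` with probability at most `1/k` (`unique`).
module Shearer {n k : ℕ} .{{_ : NonZero k}} (G : Graph n) (E : Fin n → Vec (Fin k) n → Bool)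
  (local : ∀ u v c a → u ≢ v → adj G v u ≡ false → E u (c [ v ]≔ a) ≡ E u c)
  (unique : ∀ v c a b → E v (c [ v ]≔ a) ≡ true → E v (c [ v ]≔ b) ≡ true → a ≡ b)
  where

  r : ℚ
  r = recip k

  indicator : (Fin n → Bool) → Fin n → ℚ
  indicator S u = if S u then r else 0ℚ

  Avoids : (Fin n → Bool) → Vec (Fin k) n → Set
  Avoids S c = ∀ v → S v ≡ true → E v c ≡ false

  avoids? : ∀ S c → Dec (Avoids S c)
  avoids? S c = allFin? λ v → (S v Data.Bool.≟ true) →-dec (E v c Data.Bool.≟ false)

  N : (Fin n → Bool) → ℕ
  N S = total n (λ c → ⟦ avoids? S c ⟧)

  N-anti : ∀ {S T} → T ⊆ S → N S ℕ.≤ N T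
  N-anti {S} {T} T⊆S = total-mono n λ c → ⟦⟧-mono (avoids? S c) (avoids? T c) λ h v t → h v (T⊆S v t)

  indicator-∖ : ∀ S B → mask B (indicator S) ≗ indicator (S ∖ B)
  indicator-∖ S B u with S u | B u
  ... | true  | true  = refl
  ... | true  | false = refl
  ... | false | true  = refl
  ... | false | false = refl

  Zᵢ : (Fin n → Bool) → ℚ
  Zᵢ S = Z G (indicator S)

  Zᵢ-remove : ∀ S v → S v ≡ true → Zᵢ S ≡ Zᵢ (S ∖ isᵇ v) - r * Zᵢ (S ∖ closedNbhd G v)
  Zᵢ-remove S v Sv = trans (Z-at G (indicator S) v)
    (cong₂ _-_ (Z-cong G (indicator-∖ S (isᵇ v))) (cong₂ _*_ (cong (λ b → if b then r else 0ℚ) Sv) (Z-cong G (indicator-∖ S (closedNbhd G v)))))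

  -- Whether the vertices outside N[v] are avoided does not depend on the colour of v, and of the k colours of v at most one triggers E v.
  N-remove : ∀ S v → S v ≡ true → k ℕ.* N (S ∖ isᵇ v) ℕ.≤ k ℕ.* N S ℕ.+ N (S ∖ closedNbhd G v)
  N-remove S v Sv = begin
    k ℕ.* N (S ∖ isᵇ v)
      ≤⟨ ℕP.*-monoʳ-≤ k (total-mono n λ c → ⟦⟧-≤-+ (avoids? (S ∖ isᵇ v) c) (avoids? S c) (hit? c) (cases c)) ⟩
    k ℕ.* total n (λ c → ⟦ avoids? S c ⟧ ℕ.+ ⟦ hit? c ⟧)
      ≡⟨ cong (k ℕ.*_) (total-+ n _ _) ⟩
    k ℕ.* (N S ℕ.+ total n (λ c → ⟦ hit? c ⟧))
      ≡⟨ ℕP.*-distribˡ-+ k (N S) _ ⟩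
    k ℕ.* N S ℕ.+ k ℕ.* total n (λ c → ⟦ hit? c ⟧)
      ≡⟨ cong (k ℕ.* N S ℕ.+_) (total-resample v (λ c → ⟦ hit? c ⟧)) ⟩
    k ℕ.* N S ℕ.+ total n (λ c → sum (λ a → ⟦ hit? (c [ v ]≔ a) ⟧))
      ≤⟨ ℕP.+-monoʳ-≤ (k ℕ.* N S) (total-mono n λ c → sum-unique (λ a → hit? (c [ v ]≔ a)) (avoids? U c)
           (λ a b p q → unique v c a b (proj₁ p) (proj₁ q)) (λ a p → restore c a (proj₂ p))) ⟩
    k ℕ.* N S ℕ.+ N U ∎
    where
    open ℕP.≤-Reasoning
    U : Fin n → Bool
    U = S ∖ closedNbhd G v
    Hit : Vec (Fin k) n → Set
    Hit c = E v c ≡ true × Avoids U c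
    hit? : ∀ c → Dec (Hit c)
    hit? c = (E v c Data.Bool.≟ true) ×-dec avoids? U c
    outside : ∀ u → U u ≡ true → u ≢ v × adj G v u ≡ false
    outside u h = split (isᵇ v u) (adj G v u) refl (not-true (BoolP.∧-conicalʳ (S u) _ h))
      where
      split : ∀ a b → a ≡ isᵇ v u → a ∨ b ≡ false → u ≢ v × b ≡ false
      split false b e b≡false = ∉-isᵇ (≡-sym e) , b≡false
    cases : ∀ c → Avoids (S ∖ isᵇ v) c → Avoids S c ⊎ Hit c
    cases c h with E v c in e
    ... | true  = inj₂ (refl , λ u Uu → h u (∧-true (∖-⊆ S (closedNbhd G v) u Uu) (not-false (isᵇ-≢ (proj₁ (outside u Uu))))))
    ... | false = inj₁ avoid
      where
      avoid : Avoids S c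
      avoid u Su with u ≟ v
      ... | yes refl = e
      ... | no  u≢v  = h u (∧-true Su (not-false (isᵇ-≢ u≢v)))
    restore : ∀ c a → Avoids U (c [ v ]≔ a) → Avoids U c
    restore c a h u Uu = trans (≡-sym (local u v c a (proj₁ (outside u Uu)) (proj₂ (outside u Uu)))) (h u Uu)

  module _ (top : Fin n → Bool) (positive : ∀ S → S ⊆ top → 0ℚ < Zᵢ S) where

    -- The ratio N S / Zᵢ S grows with S.
    ratio : ∀ m S T → size S ℕ.≤ m → T ⊆ S → S ⊆ top → 0ℚ ≤ ι (N S) * Zᵢ T - ι (N T) * Zᵢ S
    ratio m S T _ T⊆S S⊆top with any? (λ v → (S v Data.Bool.≟ true) ×-dec (T v Data.Bool.≟ false))
    ratio m S T _ T⊆S S⊆top | no none = subst (0ℚ ≤_) (trans (arrange (ι (N S)) (ι (N T)) (Zᵢ S)) (cong (λ z → ι (N S) * z - ι (N T) * Zᵢ S) ZS≡ZT))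
        (0≤-* (≤⇒0≤- (ι-mono (N-anti {T} {S} S⊆T))) (ℚP.<⇒≤ (positive S S⊆top)))
      where
      S⊆T : S ⊆ T
      S⊆T v Sv with T v in e
      ... | true  = refl
      ... | false = contradiction (v , Sv , e) none
      ZS≡ZT : Zᵢ S ≡ Zᵢ T
      ZS≡ZT = Z-cong G λ v → cong (λ b → if b then r else 0ℚ) (bool-iff (S⊆T v) (T⊆S v))
      arrange : ∀ a b z → (a - b) * z ≡ a * z - b * z
      arrange = solve 3 (λ a b z → (a :- b) :* z := a :* z :- b :* z) refl
        where open +-*-Solver
    ratio zero    S T le T⊆S S⊆top | yes (v , Sv , _) with () ← subst (ℕ._≤ 0) (size-∖ S v Sv) le
    -- Transitivity through `S′`: `combine` joins the cross-multiplied inequalities for `S`, `S′`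
    -- and for `S′`, `T`, after which the positive factor `Zᵢ S′` is cancelled.
    ratio (suc m) S T le T⊆S S⊆top | yes (v , Sv , Tv) = 0≤-cancel-* (positive S′ S′⊆top) (subst (0ℚ ≤_)
        (combine (ι (N S)) (ι (N S′)) (ι (N T)) (Zᵢ S) (Zᵢ S′) (Zᵢ T))
        (0≤-+ (0≤-* (ℚP.<⇒≤ (positive T λ u Tu → S⊆top u (T⊆S u Tu))) increase)
              (0≤-* (ℚP.<⇒≤ (positive S S⊆top)) (ratio m S′ T le′ T⊆S′ S′⊆top))))
      where
      S′ U : Fin n → Bool
      S′ = S ∖ isᵇ v
      U = S ∖ closedNbhd G v
      le′ : size S′ ℕ.≤ m
      le′ = ℕP.≤-pred (subst (ℕ._≤ suc m) (size-∖ S v Sv) le)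
      S′⊆top : S′ ⊆ top
      S′⊆top u h = S⊆top u (∖-⊆ S (isᵇ v) u h)
      T⊆S′ : T ⊆ S′
      T⊆S′ u Tu with u ≟ v
      ... | yes refl = contradiction (trans (≡-sym Tu) Tv) λ ()
      ... | no  u≢v  = trans (BoolP.∧-identityʳ (S u)) (T⊆S u Tu)
      U⊆S′ : U ⊆ S′
      U⊆S′ u h = split (S u) (isᵇ v u) (adj G v u) h
        where
        split : ∀ s a b → s ∧ not (a ∨ b) ≡ true → s ∧ not a ≡ true
        split true false b _ = refl
      count : 0ℚ ≤ (ι (N S) - ι (N S′)) + r * ι (N U)
      count = subst (0ℚ ≤_) (trans (spread r (ι k) (ι (N S)) (ι (N S′)) (ι (N U)))
          (trans (cong (λ t → t * ι (N S) - t * ι (N S′) + r * ι (N U)) (ι*recip k))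
            (cong₂ (λ a b → a - b + r * ι (N U)) (ℚP.*-identityˡ (ι (N S))) (ℚP.*-identityˡ (ι (N S′))))))
          (0≤-* (ℚP.<⇒≤ (0<recip k)) (≤⇒0≤- cast))
        where
        cast : ι k * ι (N S′) ≤ ι k * ι (N S) + ι (N U)
        cast = subst₂ _≤_ (ι-* k (N S′)) (trans (ι-+ (k ℕ.* N S) (N U)) (cong (_+ ι (N U)) (ι-* k (N S)))) (ι-mono (N-remove S v Sv))
        spread : ∀ r k a b c → r * (k * a + c - k * b) ≡ k * r * a - k * r * b + r * c
        spread = solve 5 (λ r k a b c → r :* (k :* a :+ c :- k :* b) := k :* r :* a :- k :* r :* b :+ r :* c) refl
          where open +-*-Solver
      -- `N S` loses at most `r * N U` against `N S′`, and `Zᵢ S` loses exactly `r * Zᵢ U` against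
      -- `Zᵢ S′`. The induction hypothesis for `U` inside `S′` says that the first loss is
      -- relatively no larger than the second.
      increase : 0ℚ ≤ ι (N S) * Zᵢ S′ - ι (N S′) * Zᵢ S
      increase = subst (0ℚ ≤_) (trans (arrange (ι (N S)) (ι (N S′)) (ι (N U)) (Zᵢ S′) (Zᵢ U) r) (cong (λ z → ι (N S) * Zᵢ S′ - ι (N S′) * z) (≡-sym (Zᵢ-remove S v Sv))))
        (0≤-+ (0≤-* (ℚP.<⇒≤ (positive S′ S′⊆top)) count) (0≤-* (ℚP.<⇒≤ (0<recip k)) (ratio m S′ U le′ U⊆S′ S′⊆top)))
        where
        arrange : ∀ a b c z w r → z * ((a - b) + r * c) + r * (b * w - c * z) ≡ a * z - b * (z - r * w)
        arrange = solve 6 (λ a b c z w r → z :* ((a :- b) :+ r :* c) :+ r :* (b :* w :- c :* z) := a :* z :- b :* (z :- r :* w)) refl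
          where open +-*-Solver
      combine : ∀ a b c x y z → z * (a * y - b * x) + x * (b * z - c * y) ≡ y * (a * z - c * x)
      combine = solve 6 (λ a b c x y z → z :* (a :* y :- b :* x) :+ x :* (b :* z :- c :* y) := y :* (a :* z :- c :* x)) refl
        where open +-*-Solver

    -- The ratio at `top` is at least the ratio at the empty set, which is positive because `N ∅`
    -- counts all colourings.
    avoidable : ∃[ c ] Avoids top c
    avoidable with N top in e
    ... | suc m = let c , h = total-witness n _ (subst (0 ℕ.<_) (≡-sym e) (s≤s z≤n)) in c , ⟦⟧-holds (avoids? top c) h
    ... | zero  = ⊥-elim (ℚP.<-irrefl refl (ℚP.<-≤-trans (subst (_< ι (N ∅) * Zᵢ top) (≡-sym (ℚP.*-zeroˡ (Zᵢ ∅))) (0<-* N∅-positive (positive top λ _ t → t)))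
                    (0≤-⇒≤ (subst (λ t → 0ℚ ≤ t * Zᵢ ∅ - ι (N ∅) * Zᵢ top) (cong ι e) (ratio (size top) top ∅ ℕP.≤-refl (λ _ ()) λ _ t → t)))))
      where
      ∅ : Fin n → Bool
      ∅ _ = false
      N∅-positive : 0ℚ < ι (N ∅)
      N∅-positive = ι-mono-< (nonempty k (λ c → ⟦ avoids? ∅ c ⟧) λ c → ⟦⟧-yes (avoids? ∅ c) λ _ ())
        where
        nonempty : ∀ k .{{_ : NonZero k}} (F : Vec (Fin k) n → ℕ) → (∀ c → 0 ℕ.< F c) → 0 ℕ.< total n F
        nonempty (suc k) F h = total-positive n F h

-- Maximal games

does⇒holds : (P? : Dec P) → does P? ≡ true → P
does⇒holds (yes p) _ = p

-- `E v` is the event that the player of `H` placed at `v` guesses correctly. Since `G` contains the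
-- edges of `H`, a guess depends only on neighbours in `G`, and never on the player's own colour, so
-- one colour at most makes it correct. Vertices outside the image carry no event, hence positivity
-- is asked only for sets inside the image.
losing : {k : ℕ} .{{_ : NonZero k}} (H : Graph m) (G : Graph n) (e : Fin m → Fin n) →
  (∀ a b → e a ≡ e b → a ≡ b) → (∀ a b → adj H a b ≡ true → adj G (e a) (e b) ≡ true) →
  (∀ S → (∀ v → S v ≡ true → ∃[ a ] e a ≡ v) → 0ℚ < Z G (λ u → if S u then recip k else 0ℚ)) →
  ¬ Winning H (★ k)
losing {m} {n} {k} H G e e-inj edges positive ((f , f-local) , wins) = contradiction (wins (colours c)) λ (a , hit) →
    contradiction (trans (≡-sym (dec-true (guess? (e a) c) (a , refl , hit))) (avoid (e a) (dec-true (image? (e a)) (a , refl)))) λ ()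
  where
  colours : Vec (Fin k) n → Fin m → Fin k
  colours c a = lookup c (e a)
  image? : ∀ v → Dec (∃[ a ] e a ≡ v)
  image? v = any? λ a → e a ≟ v
  guess? : ∀ v c → Dec (∃[ a ] e a ≡ v × f a (colours c) ≡ lookup c v)
  guess? v c = any? λ a → (e a ≟ v) ×-dec (f a (colours c) ≟ lookup c v)
  E : Fin n → Vec (Fin k) n → Bool
  E v c = does (guess? v c)
  absent : ∀ {v w u} → adj G v u ≡ false → adj G u w ≡ true → w ≢ v
  absent {v} {w} {u} v≁u u∼w refl = contradiction (trans (≡-sym u∼w) (trans (sym G u w) v≁u)) λ ()
  E-local : ∀ u v c a → u ≢ v → adj G v u ≡ false → E u (c [ v ]≔ a) ≡ E u c
  E-local u v c a u≢v v≁u = bool-iff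
      (λ h → let i , p , q = does⇒holds (guess? u (c [ v ]≔ a)) h in
        dec-true (guess? u c) (i , p , trans (≡-sym (same i p)) (trans q (lookup∘update′ u≢v c a))))
      (λ h → let i , p , q = does⇒holds (guess? u c) h in
        dec-true (guess? u (c [ v ]≔ a)) (i , p , trans (same i p) (trans q (≡-sym (lookup∘update′ u≢v c a)))))
    where
    same : ∀ i → e i ≡ u → f i (colours (c [ v ]≔ a)) ≡ f i (colours c)
    same i refl = f-local i _ _ λ b i∼b → lookup∘update′ (absent v≁u (edges i b i∼b)) c a
  E-unique : ∀ v c a b → E v (c [ v ]≔ a) ≡ true → E v (c [ v ]≔ b) ≡ true → a ≡ b
  E-unique v c a b ha hb with does⇒holds (guess? v (c [ v ]≔ a)) ha | does⇒holds (guess? v (c [ v ]≔ b)) hb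
  ... | i , refl , p | j , q , s with e-inj j i q
  ...   | refl = trans (≡-sym (lookup∘update v c a)) (trans (≡-sym p) (trans (f-local i _ _ same) (trans s (lookup∘update v c b))))
    where
    same : ∀ t → adj H i t ≡ true → colours (c [ v ]≔ a) t ≡ colours (c [ v ]≔ b) t
    same t i∼t = trans (lookup∘update′ t≢v c a) (≡-sym (lookup∘update′ t≢v c b))
      where
      t≢v : e t ≢ v
      t≢v = absent (irrefl G v) (edges i t i∼t)
  open Shearer G E E-local E-unique using (Avoids; avoidable)
  result : ∃[ c ] Avoids (λ v → does (image? v)) c
  result = avoidable (λ v → does (image? v)) λ S S⊆ → positive S λ v Sv → does⇒holds (image? v) (S⊆ v Sv)
  c : Vec (Fin k) n
  c = proj₁ result
  avoid : Avoids (λ v → does (image? v)) c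
  avoid = proj₂ result

-- Deleting an edge

module _ (G : Graph n) (u v : Fin n) where

  private
    ends : Fin n → Fin n → Bool
    ends x y = isᵇ u x ∧ isᵇ v y ∨ isᵇ v x ∧ isᵇ u y

    ends-sym : ∀ x y → ends x y ≡ ends y x
    ends-sym x y = trans (BoolP.∨-comm (isᵇ u x ∧ isᵇ v y) (isᵇ v x ∧ isᵇ u y))
      (cong₂ _∨_ (BoolP.∧-comm (isᵇ v x) (isᵇ u y)) (BoolP.∧-comm (isᵇ u x) (isᵇ v y)))

  deleteEdge : Graph n
  deleteEdge = record
    { adj    = λ x y → adj G x y ∧ not (ends x y)
    ; sym    = λ x y → cong₂ (λ a b → a ∧ not b) (sym G x y) (ends-sym x y)
    ; irrefl = λ x → cong (_∧ not (ends x x)) (irrefl G x)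
    }

  adj-deleteEdge : ∀ x y → ¬ (x ≡ u × y ≡ v) → ¬ (x ≡ v × y ≡ u) → adj deleteEdge x y ≡ adj G x y
  adj-deleteEdge x y h₁ h₂ with x ≟ u | y ≟ v | x ≟ v | y ≟ u
  ... | yes p | yes q | _     | _     = contradiction (p , q) h₁
  ... | _     | _     | yes p | yes q = contradiction (p , q) h₂
  ... | yes _ | no  _ | yes _ | no  _ = BoolP.∧-identityʳ (adj G x y)
  ... | yes _ | no  _ | no  _ | yes _ = BoolP.∧-identityʳ (adj G x y)
  ... | yes _ | no  _ | no  _ | no  _ = BoolP.∧-identityʳ (adj G x y)
  ... | no  _ | yes _ | yes _ | no  _ = BoolP.∧-identityʳ (adj G x y)
  ... | no  _ | yes _ | no  _ | yes _ = BoolP.∧-identityʳ (adj G x y)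
  ... | no  _ | yes _ | no  _ | no  _ = BoolP.∧-identityʳ (adj G x y)
  ... | no  _ | no  _ | yes _ | no  _ = BoolP.∧-identityʳ (adj G x y)
  ... | no  _ | no  _ | no  _ | yes _ = BoolP.∧-identityʳ (adj G x y)
  ... | no  _ | no  _ | no  _ | no  _ = BoolP.∧-identityʳ (adj G x y)

  deleted : adj deleteEdge v u ≡ false
  deleted rewrite isᵇ-refl u | isᵇ-refl v | BoolP.∨-zeroʳ (isᵇ u v ∧ isᵇ v u) = BoolP.∧-zeroʳ (adj G v u)

  -- Expand the smaller graph at `v`. In both terms `v` is masked, so the edge may be restored by
  -- `Z-agree`. The one difference from the expansion of `G` is that `u` survives the masking around
  -- `v`; expanding once more at `u` isolates its contribution.
  Z-deleteEdge : adj G u v ≡ true → (x : Fin n → ℚ) →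
    Z deleteEdge x ≡ Z G x + x u * x v * Z G (mask (closedNbhd G u) (mask (closedNbhd G v) x))
  Z-deleteEdge u∼v x = begin
    Z deleteEdge x
      ≡⟨ Z-at deleteEdge x v ⟩
    Z deleteEdge (mask (isᵇ v) x) - x v * Z deleteEdge w
      ≡⟨ cong₂ (λ a b → a - x v * b) (Z-agree deleteEdge G (mask (isᵇ v) x) _ (λ _ → refl) (agree (mask (isᵇ v) x) (mask-at (isᵇ v) x (isᵇ-refl v))))
           (Z-agree deleteEdge G w _ (λ _ → refl) (agree w (mask-at (closedNbhd deleteEdge v) x (cong (_∨ adj deleteEdge v v) (isᵇ-refl v))))) ⟩
    α - x v * Z G w
      ≡⟨ cong (λ b → α - x v * b) (Z-at G w u) ⟩
    α - x v * (Z G (mask (isᵇ u) w) - w u * Z G (mask (closedNbhd G u) w))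
      ≡⟨ cong₂ (λ b c → α - x v * (b - c)) (Z-cong G at-u) (cong₂ _*_ w-u (Z-cong G near-u)) ⟩
    α - x v * (β - x u * γ)
      ≡⟨ arrange α (x v) β (x u) γ ⟩
    (α - x v * β) + x u * x v * γ
      ≡⟨ cong (_+ x u * x v * γ) (Z-at G x v) ⟨
    Z G x + x u * x v * γ ∎
    where
    open ≡-Reasoning
    w : Fin n → ℚ
    w = mask (closedNbhd deleteEdge v) x
    α β γ : ℚ
    α = Z G (mask (isᵇ v) x)
    β = Z G (mask (closedNbhd G v) x)
    γ = Z G (mask (closedNbhd G u) (mask (closedNbhd G v) x))
    arrange : ∀ a p b q c → a - p * (b - q * c) ≡ (a - p * b) + q * p * c
    arrange = solve 5 (λ a p b q c → a :- p :* (b :- q :* c) := (a :- p :* b) :+ q :* p :* c) refl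
      where open +-*-Solver
    u≢v : u ≢ v
    u≢v refl = contradiction (trans (≡-sym u∼v) (irrefl G u)) λ ()
    mask-at : ∀ B y {t} → B t ≡ true → mask B y t ≡ 0ℚ
    mask-at B y {t} e = cong (λ b → if b then 0ℚ else y t) e
    agree : ∀ y → y v ≡ 0ℚ → ∀ s t → y s ≢ 0ℚ → y t ≢ 0ℚ → adj deleteEdge s t ≡ adj G s t
    agree y yv s t ys yt = adj-deleteEdge s t (λ { (_ , refl) → yt yv }) (λ { (refl , _) → ys yv })
    closed-≢ : ∀ {t} → t ≢ u → closedNbhd deleteEdge v t ≡ closedNbhd G v t
    closed-≢ {t} t≢u = cong (isᵇ v t ∨_) (adj-deleteEdge v t (λ { (refl , _) → u≢v refl }) (λ { (_ , t≡u) → t≢u t≡u }))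
    w-u : w u ≡ x u
    w-u = cong (λ b → if b then 0ℚ else x u) (cong₂ _∨_ (isᵇ-≢ u≢v) deleted)
    off-u : ∀ {t} → t ≢ u → w t ≡ mask (closedNbhd G v) x t
    off-u {t} t≢u = cong (λ b → if b then 0ℚ else x t) (closed-≢ t≢u)
    at-u : mask (isᵇ u) w ≗ mask (closedNbhd G v) x
    at-u t = cases (t ≟ u)
      where
      cases : Dec (t ≡ u) → mask (isᵇ u) w t ≡ mask (closedNbhd G v) x t
      cases (yes refl) = trans (mask-at (isᵇ u) w {u} (isᵇ-refl u))
        (≡-sym (mask-at (closedNbhd G v) x (trans (cong (isᵇ v u ∨_) (trans (sym G v u) u∼v)) (BoolP.∨-zeroʳ (isᵇ v u)))))
      cases (no t≢u) = trans (cong (λ b → if b then 0ℚ else w t) (isᵇ-≢ t≢u)) (off-u t≢u)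
    near-u : mask (closedNbhd G u) w ≗ mask (closedNbhd G u) (mask (closedNbhd G v) x)
    near-u t = cases (t ≟ u)
      where
      u-near-u : closedNbhd G u u ≡ true
      u-near-u = cong (_∨ adj G u u) (isᵇ-refl u)
      cases : Dec (t ≡ u) → mask (closedNbhd G u) w t ≡ mask (closedNbhd G u) (mask (closedNbhd G v) x) t
      cases (yes refl) = trans (mask-at (closedNbhd G u) w u-near-u) (≡-sym (mask-at (closedNbhd G u) (mask (closedNbhd G v) x) u-near-u))
      cases (no t≢u) = cong (λ q → if closedNbhd G u t then 0ℚ else q) (off-u t≢u)

module _ (G : Graph n) (h : ℕ) .{{_ : NonZero h}} (maximal : MaximalConst G h) where

  private
    Bounded : (Fin n → ℚ) → Set
    Bounded x = ∀ v → 0ℚ ≤ x v × x v ≤ recip h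

    0≢recip : 0ℚ ≢ recip h
    0≢recip e = ℚP.<⇒≢ (0<recip h) e

    Z-positive : ∀ x → Bounded x → ∀ v → x v ≢ recip h → 0ℚ < Z G x
    Z-positive x bounded v x≢ = proj₂ maximal x bounded λ all → x≢ (all v)

    module _ {k : ℕ} .{{_ : NonZero k}} (h≤k : h ℕ.≤ k) (S : Fin n → Bool) where

      x : Fin n → ℚ
      x u = if S u then recip k else 0ℚ

      bounded : Bounded x
      bounded u with S u
      ... | true  = ℚP.<⇒≤ (0<recip k) , recip-anti h≤k
      ... | false = ℚP.≤-refl , ℚP.<⇒≤ (0<recip h)

  losing-larger : ∀ k → h ℕ.< k → ¬ Winning G (★ k)
  losing-larger k@(suc _) h<k = losing G G id (λ _ _ e → e) (λ _ _ e → e) λ S _ →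
    proj₂ maximal (x (ℕP.<⇒≤ h<k) S) (bounded (ℕP.<⇒≤ h<k) S) (not-all n G (proj₁ maximal) S)
    where
    not-all : ∀ n (G : Graph n) → Z G (λ _ → recip h) ≡ 0ℚ → (S : Fin n → Bool) → ¬ (∀ v → (if S v then recip k else 0ℚ) ≡ recip h)
    -- On the empty graph all coordinates equal `1/h` vacuously, but there `Z` is 1, contrary to
    -- maximality.
    not-all zero    G () S all
    not-all (suc n) G _  S all with S zero | all zero
    ... | true  | e = recip-≢ h<k e
    ... | false | e = 0≢recip e

  losing-subgraph : (S : ProperSubgraph G) → ∀ k → h ℕ.≤ k → ¬ Winning (ProperSubgraph.H S) (★ k)
  losing-subgraph sub zero h≤0 = contradiction (ℕP.≤-antisym h≤0 z≤n) (ℕ.≢-nonZero⁻¹ h)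
  losing-subgraph sub k@(suc _) h≤k = split (ProperSubgraph.proper sub)
    where
    open ProperSubgraph sub renaming (ι to e; ι-inj to e-inj; m to size-H)
    split : (size-H ℕ.< n) ⊎ (∃[ a ] ∃[ b ] (adj G (e a) (e b) ≡ true × adj H a b ≡ false)) → ¬ Winning H (★ k)
    -- `S` lies in the image of fewer than `n` vertices, so by the pigeonhole principle some
    -- coordinate is 0 and the vector differs from the constant `1/h`.
    split (inj₁ fewer) = losing H G e e-inj edges λ S S⊆image → proj₂ maximal (x h≤k S) (bounded h≤k S) λ all →
      let preimage : ∀ v → ∃[ a ] e a ≡ v
          preimage v = S⊆image v (member S v (all v))
          i , j , i<j , same = pigeonhole fewer (λ v → proj₁ (preimage v))
      in <⇒≢ i<j (trans (≡-sym (proj₂ (preimage i))) (trans (cong e same) (proj₂ (preimage j))))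
      where
      member : ∀ S v → x h≤k S v ≡ recip h → S v ≡ true
      member S v eq with S v
      ... | true  = refl
      ... | false = contradiction eq 0≢recip
    split (inj₂ (a , b , edge , non-edge)) = losing H (deleteEdge G u v) e e-inj edges′ positive
      where
      u v : Fin n
      u = e a
      v = e b
      edges′ : ∀ s t → adj H s t ≡ true → adj (deleteEdge G u v) (e s) (e t) ≡ true
      edges′ s t s∼t = trans (adj-deleteEdge G u v (e s) (e t)
          (λ (p , q) → clash (e-inj s a p) (e-inj t b q) s∼t)
          (λ (p , q) → clash (e-inj t a q) (e-inj s b p) (trans (sym H t s) s∼t)))
        (edges s t s∼t)
        where
        clash : ∀ {s t} → s ≡ a → t ≡ b → adj H s t ≡ true → ⊥
        clash refl refl p = contradiction (trans (≡-sym p) non-edge) λ ()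
      positive : ∀ S → _ → 0ℚ < Z (deleteEdge G u v) (x h≤k S)
      positive S _ = subst (0ℚ <_) (≡-sym (Z-deleteEdge G u v edge y)) (sum-positive (allFin? λ t → y t ℚP.≟ recip h))
        where
        y w : Fin n → ℚ
        y = x h≤k S
        w = mask (closedNbhd G u) (mask (closedNbhd G v) y)
        mask-bounded : ∀ B {z} → Bounded z → Bounded (mask B z)
        mask-bounded B bz t with B t
        ... | true  = ℚP.≤-refl , ℚP.<⇒≤ (0<recip h)
        ... | false = bz t
        w-u : w u ≡ 0ℚ
        w-u = cong (λ c → if c ∨ adj G u u then 0ℚ else mask (closedNbhd G v) y u) (isᵇ-refl u)
        C-positive : 0ℚ < Z G w
        C-positive = Z-positive w (mask-bounded (closedNbhd G u) (mask-bounded (closedNbhd G v) (bounded h≤k S))) u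
          λ eq → 0≢recip (trans (≡-sym w-u) eq)
        -- If every coordinate is `1/h`, then `Z G y` vanishes and the term gained from the edge is
        -- positive. Otherwise `Z G y` itself is positive and the gain is non-negative.
        sum-positive : Dec (∀ t → y t ≡ recip h) → 0ℚ < Z G y + y u * y v * Z G w
        sum-positive (yes all) = 0≤-+-0< (ℚP.≤-reflexive (≡-sym (trans (Z-cong G all) (proj₁ maximal))))
          (0<-* (0<-* (subst (0ℚ <_) (≡-sym (all u)) (0<recip h)) (subst (0ℚ <_) (≡-sym (all v)) (0<recip h))) C-positive)
        sum-positive (no ¬all) = 0<-+-0≤ (proj₂ maximal y (bounded h≤k S) ¬all)
          (0≤-* (0≤-* (proj₁ (bounded h≤k S u)) (proj₁ (bounded h≤k S v))) (ℚP.<⇒≤ C-positive))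

  minimal : Winning G (★ h) → Minimal G h
  minimal wins = (wins , losing-larger) , losing-subgraph , maximal

-- Chains of cliques: maximality

attach : Graph n → (Fin n → Bool) → Graph (suc n)
attach {n} G Q = record { adj = edge ; sym = edge-sym ; irrefl = edge-irrefl }
  where
  edge : Fin (suc n) → Fin (suc n) → Bool
  edge zero    zero    = false
  edge zero    (suc v) = Q v
  edge (suc u) zero    = Q u
  edge (suc u) (suc v) = adj G u v
  edge-sym : ∀ u v → edge u v ≡ edge v u
  edge-sym zero    zero    = refl
  edge-sym zero    (suc v) = refl
  edge-sym (suc u) zero    = refl
  edge-sym (suc u) (suc v) = sym G u v
  edge-irrefl : ∀ v → edge v v ≡ false
  edge-irrefl zero    = refl
  edge-irrefl (suc v) = irrefl G v

-- Chain h n p j: n vertices in j cliques, with ratio p / h still to be filled in the last clique.  The newest vertex is zero; grow puts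
-- it into the last clique at ratio 1 / h, while turn fills that clique (its ratio there is p / h = 1 / q) and starts the next one with ratio 1 / p.
data Chain (h : ℕ) : ℕ → ℕ → ℕ → Set where
  empty : Chain h 0 h 0
  grow  : Chain h n (suc p) (suc j) → Chain h (suc n) p (suc j)
  turn  : ∀ p q .{{_ : NonZero p}} .{{_ : NonZero q}} → h ≡ p ℕ.* q → h ≡ p′ ℕ.+ q →
          Chain h n p j → Chain h (suc n) p′ (suc j)

clique : Chain h n p j → Fin n → Bool
clique (grow C)         zero    = true
clique (grow C)         (suc v) = clique C v
clique (turn _ _ _ _ C) zero    = true
clique (turn _ _ _ _ C) (suc v) = false

graph : Chain h n p j → Graph n
graph empty            = record { adj = λ () ; sym = λ () ; irrefl = λ () }
graph (grow C)         = attach (graph C) (clique C)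
graph (turn _ _ _ _ C) = attach (graph C) (clique C)

module _ {h : ℕ} .{{_ : NonZero h}} where

  private
    r : ℚ
    r = recip h

    Bounded : (Fin n → ℚ) → Set
    Bounded x = ∀ v → 0ℚ ≤ x v × x v ≤ r

  -- By `Z-suc`, the factor by which the variable of any further vertex of the last clique is
  -- multiplied.
  link : Chain h n p j → (Fin n → ℚ) → ℚ
  link C x = Z (graph C) (mask (clique C) x)

  -- Z (graph C) x with the shared vertex, at its remaining ratio p / h, adjoined to the last clique.
  defect : Chain h n p j → (Fin n → ℚ) → ℚ
  defect {p = p} C x = Z (graph C) x - ι p * r * link C x

  private
    drop : ∀ a b → a - 0ℚ * b ≡ a
    drop = solve 2 (λ a b → a :- con 0ℚ :* b := a) refl
      where open +-*-Solver

  link-grow : (C : Chain h n (suc p) (suc j)) (x : Fin (suc n) → ℚ) → link (grow C) x ≡ link C (x ∘ suc)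
  link-grow C x = trans (Z-suc (graph (grow C)) (mask (clique (grow C)) x))
    (drop (link C (x ∘ suc)) (Z (graph C) (mask (clique C) (mask (clique C) (x ∘ suc)))))

  link-turn : ∀ p q .{{_ : NonZero p}} .{{_ : NonZero q}} (e : h ≡ p ℕ.* q) (e′ : h ≡ p′ ℕ.+ q) (C : Chain h n p j) (x : Fin (suc n) → ℚ) →
    link (turn p q e e′ C) x ≡ Z (graph C) (x ∘ suc)
  link-turn p q e e′ C x = trans (Z-suc (graph (turn p q e e′ C)) (mask (clique (turn p q e e′ C)) x))
    (drop (Z (graph C) (x ∘ suc)) (Z (graph C) (mask (clique C) (x ∘ suc))))

  -- A real vertex replaces one unit `1/h` of the reserved ratio, so only the shortfall `r - x zero`
  -- is felt.
  defect-grow : (C : Chain h n (suc p) (suc j)) (x : Fin (suc n) → ℚ) →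
    defect (grow C) x ≡ defect C (x ∘ suc) + (r - x zero) * link C (x ∘ suc)
  defect-grow {p = p} C x = trans (cong₂ (λ a b → a - ι p * r * b) (Z-suc (graph (grow C)) x) (link-grow C x))
    (arrange (Z (graph C) (x ∘ suc)) (link C (x ∘ suc)) (x zero) (ι p) r)
    where
    arrange : ∀ a l t p r → a - t * l - p * r * l ≡ a - (1ℚ + p) * r * l + (r - t) * l
    arrange = solve 5 (λ a l t p r → a :- t :* l :- p :* r :* l := a :- (con 1ℚ :+ p) :* r :* l :+ (r :- t) :* l) refl
      where open +-*-Solver

  -- The new clique is `zero` alone, so its link is the old `Z`. The two equations for `h` become
  -- `(ι p′ + ι q) * r ≡ 1ℚ` and `ι p * ι q * r ≡ 1ℚ`; the second makes the old defect reappear with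
  -- factor `q / h`.
  defect-turn : ∀ p q .{{_ : NonZero p}} .{{_ : NonZero q}} (e : h ≡ p ℕ.* q) (e′ : h ≡ p′ ℕ.+ q) (C : Chain h n p j) (x : Fin (suc n) → ℚ) →
    defect (turn p q e e′ C) x ≡ ι q * r * defect C (x ∘ suc) + (r - x zero) * link C (x ∘ suc)
  defect-turn {p′ = p′} p q e e′ C x = begin
    defect (turn p q e e′ C) x
      ≡⟨ cong₂ (λ a b → a - ι p′ * r * b) (Z-suc (graph (turn p q e e′ C)) x) (link-turn p q e e′ C x) ⟩
    a - t * l - ι p′ * r * a
      ≡⟨ one ⟨
    (ι p′ + ι q) * r * a - t * l - ι p′ * r * a
      ≡⟨ arrange₁ a l t (ι p′) (ι q) r ⟩
    ι q * r * a - t * l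
      ≡⟨ arrange₂ a l t (ι p) (ι q) r ⟩
    ι q * r * (a - ι p * r * l) + (ι p * ι q * r * r - t) * l
      ≡⟨ cong (λ s → ι q * r * (a - ι p * r * l) + (s * r - t) * l) (trans (cong (_* r) (trans (≡-sym (ι-* p q)) (cong ι (≡-sym e)))) (ι*recip h)) ⟩
    ι q * r * (a - ι p * r * l) + (1ℚ * r - t) * l
      ≡⟨ cong (λ s → ι q * r * (a - ι p * r * l) + (s - t) * l) (ℚP.*-identityˡ r) ⟩
    ι q * r * defect C (x ∘ suc) + (r - t) * l ∎
    where
    open ≡-Reasoning
    a l t : ℚ
    a = Z (graph C) (x ∘ suc)
    l = link C (x ∘ suc)
    t = x zero
    one : (ι p′ + ι q) * r * a - t * l - ι p′ * r * a ≡ a - t * l - ι p′ * r * a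
    one = cong (λ s → s - t * l - ι p′ * r * a) (trans (cong (λ s → s * r * a) (trans (≡-sym (ι-+ p′ q)) (cong ι (≡-sym e′)))) (trans (cong (_* a) (ι*recip h)) (ℚP.*-identityˡ a)))
    arrange₁ : ∀ a l t p q r → (p + q) * r * a - t * l - p * r * a ≡ q * r * a - t * l
    arrange₁ = solve 6 (λ a l t p q r → (p :+ q) :* r :* a :- t :* l :- p :* r :* a := q :* r :* a :- t :* l) refl
      where open +-*-Solver
    arrange₂ : ∀ a l t p q r → q * r * a - t * l ≡ q * r * (a - p * r * l) + (p * q * r * r - t) * l
    arrange₂ = solve 6 (λ a l t p q r → q :* r :* a :- t :* l := q :* r :* (a :- p :* r :* l) :+ (p :* q :* r :* r :- t) :* l) refl
      where open +-*-Solver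

  defect-tight : (C : Chain h n p j) (x : Fin n → ℚ) → (∀ v → x v ≡ r) → defect C x ≡ 0ℚ
  defect-tight empty x tight = trans (cong (λ s → 1ℚ - s * 1ℚ) (ι*recip h)) refl
  defect-tight (grow C) x tight = trans (defect-grow C x)
    (trans (cong₂ (λ s t → s + (r - t) * link C (x ∘ suc)) (defect-tight C (x ∘ suc) (tight ∘ suc)) (tight zero)) (vanish r (link C (x ∘ suc))))
    where
    vanish : ∀ r l → 0ℚ + (r - r) * l ≡ 0ℚ
    vanish = solve 2 (λ r l → con 0ℚ :+ (r :- r) :* l := con 0ℚ) refl
      where open +-*-Solver
  defect-tight (turn p q e e′ C) x tight = trans (defect-turn p q e e′ C x)
    (trans (cong₂ (λ s t → ι q * r * s + (r - t) * link C (x ∘ suc)) (defect-tight C (x ∘ suc) (tight ∘ suc)) (tight zero)) (vanish (ι q * r) r (link C (x ∘ suc))))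
    where
    vanish : ∀ s r l → s * 0ℚ + (r - r) * l ≡ 0ℚ
    vanish = solve 3 (λ s r l → s :* con 0ℚ :+ (r :- r) :* l := con 0ℚ) refl
      where open +-*-Solver

  private
    0<ι′ : ∀ m .{{_ : NonZero m}} → 0ℚ < ι m
    0<ι′ (suc m) = 0<ι m

    below : (x : Fin (suc n) → ℚ) → Bounded x → x zero ≢ r → 0ℚ < r - x zero
    below x b ne = <⇒0<- (≤∧≢⇒< (proj₂ (b zero)) ne)

    tight-suc : (x : Fin (suc n) → ℚ) → x zero ≡ r → ¬ (∀ v → x v ≡ r) → ¬ (∀ v → x (suc v) ≡ r)
    tight-suc x eq loose all = loose λ { zero → eq ; (suc v) → all v }

  mutual
    -- At `turn` the link becomes the old `Z`, which is the old defect plus `p / h` times the old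
    -- link. Thus positive links rest on non-negative defects, and these in turn on positive links.
    link-positive : (C : Chain h n p j) (x : Fin n → ℚ) → Bounded x → 0ℚ < link C x
    link-positive empty x b = ℚP.positive⁻¹ 1ℚ
    link-positive (grow C) x b = subst (0ℚ <_) (≡-sym (link-grow C x)) (link-positive C (x ∘ suc) (b ∘ suc))
    link-positive (turn p q e e′ C) x b = subst (0ℚ <_)
      (trans (restore (Z (graph C) (x ∘ suc)) (ι p * r * link C (x ∘ suc))) (≡-sym (link-turn p q e e′ C x)))
      (0≤-+-0< (defect-nonneg C (x ∘ suc) (b ∘ suc)) (0<-* (0<-* (0<ι′ p) (0<recip h)) (link-positive C (x ∘ suc) (b ∘ suc))))
      where
      restore : ∀ a b → a - b + b ≡ a
      restore = solve 2 (λ a b → a :- b :+ b := a) refl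
        where open +-*-Solver

    defect-nonneg : (C : Chain h n p j) (x : Fin n → ℚ) → Bounded x → 0ℚ ≤ defect C x
    defect-nonneg empty x b = ℚP.≤-reflexive (≡-sym (defect-tight empty x λ ()))
    defect-nonneg (grow C) x b = subst (0ℚ ≤_) (≡-sym (defect-grow C x))
      (0≤-+ (defect-nonneg C (x ∘ suc) (b ∘ suc)) (0≤-* (≤⇒0≤- (proj₂ (b zero))) (ℚP.<⇒≤ (link-positive C (x ∘ suc) (b ∘ suc)))))
    defect-nonneg (turn p q e e′ C) x b = subst (0ℚ ≤_) (≡-sym (defect-turn p q e e′ C x))
      (0≤-+ (0≤-* (0≤-* (0≤ι q) (ℚP.<⇒≤ (0<recip h))) (defect-nonneg C (x ∘ suc) (b ∘ suc)))
        (0≤-* (≤⇒0≤- (proj₂ (b zero))) (ℚP.<⇒≤ (link-positive C (x ∘ suc) (b ∘ suc)))))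

  -- A shortfall at the newest vertex is multiplied by a positive link. A shortfall further back is
  -- carried on with the positive factor 1 or `q / h`.
  defect-loose : (C : Chain h n p j) (x : Fin n → ℚ) → Bounded x → ¬ (∀ v → x v ≡ r) → 0ℚ < defect C x
  defect-loose empty x b loose = contradiction (λ ()) loose
  defect-loose (grow C) x b loose = subst (0ℚ <_) (≡-sym (defect-grow C x)) (split (x zero ℚP.≟ r))
    where
    l : 0ℚ < link C (x ∘ suc)
    l = link-positive C (x ∘ suc) (b ∘ suc)
    split : Dec (x zero ≡ r) → 0ℚ < defect C (x ∘ suc) + (r - x zero) * link C (x ∘ suc)
    split (yes eq) = 0<-+-0≤ (defect-loose C (x ∘ suc) (b ∘ suc) (tight-suc x eq loose)) (0≤-* (≤⇒0≤- (proj₂ (b zero))) (ℚP.<⇒≤ l))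
    split (no ne)  = 0≤-+-0< (defect-nonneg C (x ∘ suc) (b ∘ suc)) (0<-* (below x b ne) l)
  defect-loose (turn p q e e′ C) x b loose = subst (0ℚ <_) (≡-sym (defect-turn p q e e′ C x)) (split (x zero ℚP.≟ r))
    where
    l : 0ℚ < link C (x ∘ suc)
    l = link-positive C (x ∘ suc) (b ∘ suc)
    s : 0ℚ < ι q * r
    s = 0<-* (0<ι′ q) (0<recip h)
    split : Dec (x zero ≡ r) → 0ℚ < ι q * r * defect C (x ∘ suc) + (r - x zero) * link C (x ∘ suc)
    split (yes eq) = 0<-+-0≤ (0<-* s (defect-loose C (x ∘ suc) (b ∘ suc) (tight-suc x eq loose))) (0≤-* (≤⇒0≤- (proj₂ (b zero))) (ℚP.<⇒≤ l))
    split (no ne)  = 0≤-+-0< (0≤-* (ℚP.<⇒≤ s) (defect-nonneg C (x ∘ suc) (b ∘ suc))) (0<-* (below x b ne) l)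

  -- With `p = 0` nothing is reserved and the defect is `Z` itself.
  chain-maximal : (C : Chain h n 0 j) → MaximalConst (graph C) h
  chain-maximal C = trans (≡-sym (defect≡Z (λ _ → r))) (defect-tight C (λ _ → r) λ _ → refl) ,
    λ x b loose → subst (0ℚ <_) (defect≡Z x) (defect-loose C x b loose)
    where
    defect≡Z : ∀ x → defect C x ≡ Z (graph C) x
    defect≡Z x = collapse (Z (graph C) x) r (link C x)
      where
      collapse : ∀ a r l → a - 0ℚ * r * l ≡ a
      collapse = solve 3 (λ a r l → a :- con 0ℚ :* r :* l := a) refl
        where open +-*-Solver

-- Chains of cliques: winning strategy and diameter

%-+-cancelʳ : ∀ h .{{_ : NonZero h}} s {x y} → x ℕ.< h → y ℕ.< h → (x ℕ.+ s) % h ≡ (y ℕ.+ s) % h → x ≡ y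
%-+-cancelʳ h@(suc h′) s {x} {y} x<h y<h e = begin
  x                                          ≡⟨ recover x<h ⟩
  -- As `h′` is -1 modulo `h`, adding `s * h′` undoes the shift by `s`.
  ((x ℕ.+ s) % h ℕ.+ (s ℕ.* h′) % h) % h     ≡⟨ cong (λ t → (t ℕ.+ (s ℕ.* h′) % h) % h) e ⟩
  ((y ℕ.+ s) % h ℕ.+ (s ℕ.* h′) % h) % h     ≡⟨ recover y<h ⟨
  y                                          ∎
  where
  open ≡-Reasoning
  recover : ∀ {x} → x ℕ.< h → x ≡ ((x ℕ.+ s) % h ℕ.+ (s ℕ.* h′) % h) % h
  recover {x} x<h = begin
    x                                        ≡⟨ m<n⇒m%n≡m x<h ⟨
    x % h                                    ≡⟨ [m+kn]%n≡m%n x s h ⟨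
    (x ℕ.+ s ℕ.* h) % h                      ≡⟨ cong (λ t → (x ℕ.+ t) % h) (ℕP.*-suc s h′) ⟩
    (x ℕ.+ (s ℕ.+ s ℕ.* h′)) % h             ≡⟨ cong (_% h) (ℕP.+-assoc x s (s ℕ.* h′)) ⟨
    (x ℕ.+ s ℕ.+ s ℕ.* h′) % h               ≡⟨ %-distribˡ-+ (x ℕ.+ s) (s ℕ.* h′) h ⟩
    ((x ℕ.+ s) % h ℕ.+ (s ℕ.* h′) % h) % h   ∎

-- The residues p a + s with a < q lie in distinct windows [i p , (i + 1) p).
window-injective : ∀ h p q .{{_ : NonZero h}} .{{_ : NonZero p}} → h ≡ p ℕ.* q → ∀ s {a b} → a ℕ.< q → b ℕ.< q →
  (p ℕ.* a ℕ.+ s) % h / p ≡ (p ℕ.* b ℕ.+ s) % h / p → a ≡ b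
window-injective h p q h≡pq s {a} {b} a<q b<q e =
  ℕP.*-cancelˡ-≡ a b p (%-+-cancelʳ h s (small a<q) (small b<q) (begin
    (p ℕ.* a ℕ.+ s) % h                                         ≡⟨ m≡m%n+[m/n]*n _ p ⟩
    (p ℕ.* a ℕ.+ s) % h % p ℕ.+ (p ℕ.* a ℕ.+ s) % h / p ℕ.* p   ≡⟨ cong₂ (λ t w → t ℕ.+ w ℕ.* p) (trans (offset a) (≡-sym (offset b))) e ⟩
    (p ℕ.* b ℕ.+ s) % h % p ℕ.+ (p ℕ.* b ℕ.+ s) % h / p ℕ.* p   ≡⟨ m≡m%n+[m/n]*n _ p ⟨
    (p ℕ.* b ℕ.+ s) % h                                         ∎))
  where
  open ≡-Reasoning
  small : ∀ {a} → a ℕ.< q → p ℕ.* a ℕ.< h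
  small a<q = subst (_ ℕ.<_) (≡-sym h≡pq) (ℕP.*-monoʳ-< p a<q)
  offset : ∀ a → (p ℕ.* a ℕ.+ s) % h % p ≡ s % p
  offset a = trans (m∣n⇒o%n%m≡o%m p h _ (subst (p ∣_) (≡-sym h≡pq) (m∣m*n q))) (%-remove-+ˡ s (m∣m*n a))

module _ {h : ℕ} .{{_ : NonZero h}} where

  -- A strategy must always answer, so colour 0 is the default when no colour fits; `find-unique` is
  -- applied where the actual colour fits.
  find : {P : Fin h → Set} → (∀ x → Dec (P x)) → Fin h
  find P? with any? P?
  ... | yes (x , _) = x
  ... | no  _       = fromℕ< (ℕ.>-nonZero⁻¹ h)

  find-unique : {P : Fin h → Set} (P? : ∀ x → Dec (P x)) {x : Fin h} → P x → (∀ y → P y → y ≡ x) → find P? ≡ x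
  find-unique P? {x} px unique with any? P?
  ... | yes (y , py) = unique y py
  ... | no  none     = contradiction (x , px) none

  -- The share of the last clique's sum due to the vertices already placed. A shared vertex enters
  -- with its low digit times `q`, so that its `p` digit values move the sum through the `p` windows
  -- of length `q`.
  offset : Chain h n p j → (Fin n → Fin h) → ℕ
  offset empty            c = 0
  offset (grow C)         c = toℕ (c zero) ℕ.+ offset C (c ∘ suc)
  offset (turn p q _ _ C) c = q ℕ.* (toℕ (c zero) % p)

  growTarget? : ∀ p s t (x : Fin h) → Dec ((toℕ x ℕ.+ s ℕ.+ t) % h ≡ p)
  growTarget? p s t x = (toℕ x ℕ.+ s ℕ.+ t) % h ℕ.≟ p

  -- The digits of x are toℕ x / p (a residue mod q, for the old clique) and toℕ x % p (for the new one).
  turnTarget? : ∀ p q .{{_ : NonZero p}} .{{_ : NonZero q}} s t (x : Fin h) →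
    Dec ((p ℕ.* (toℕ x / p) ℕ.+ s) % h / p ≡ 0 × (q ℕ.* (toℕ x % p) ℕ.+ t) % h / q ≡ ℕ.pred p)
  turnTarget? p q s t x = ((p ℕ.* (toℕ x / p) ℕ.+ s) % h / p ℕ.≟ 0) ×-dec ((q ℕ.* (toℕ x % p) ℕ.+ t) % h / q ℕ.≟ ℕ.pred p)

  -- t is the contribution to the sum over the last clique of the vertices still to be added to it.
  guess : Chain h n p j → Fin n → (Fin n → Fin h) → ℕ → Fin h
  guess (grow {p = p} C)   zero    c t = find (growTarget? p (offset C (c ∘ suc)) t)
  guess (grow C)           (suc v) c t = guess C v (c ∘ suc) (toℕ (c zero) ℕ.+ t)
  guess (turn p q _ _ C)   zero    c t = find (turnTarget? p q (offset C (c ∘ suc)) t)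
  guess (turn p q _ _ C)   (suc v) c t = guess C v (c ∘ suc) (p ℕ.* (toℕ (c zero) / p))

  offset-local : (C : Chain h n p j) {c c′ : Fin n → Fin h} → (∀ u → clique C u ≡ true → c u ≡ c′ u) → offset C c ≡ offset C c′
  offset-local empty            e = refl
  offset-local (grow C)         e = cong₂ (λ x s → toℕ x ℕ.+ s) (e zero refl) (offset-local C (e ∘ suc))
  offset-local (turn p q _ _ C) e = cong (λ x → q ℕ.* (toℕ x % p)) (e zero refl)

  -- `t` comes from later vertices of the last clique, which `v` sees when it belongs to that
  -- clique; agreement of `t` and `t′` can be demanded only then.
  guess-local : (C : Chain h n p j) (v : Fin n) {c c′ : Fin n → Fin h} {t t′ : ℕ} →
    (∀ u → adj (graph C) v u ≡ true → c u ≡ c′ u) → (clique C v ≡ true → t ≡ t′) → guess C v c t ≡ guess C v c′ t′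
  guess-local (grow {p = p} C) zero e te = cong₂ (λ s t → find (growTarget? p s t)) (offset-local C (e ∘ suc)) (te refl)
  guess-local (grow C) (suc v) e te = guess-local C v (e ∘ suc) λ Qv → cong₂ (λ x t → toℕ x ℕ.+ t) (e zero Qv) (te Qv)
  guess-local (turn p q _ _ C) zero e te = cong₂ (λ s t → find (turnTarget? p q s t)) (offset-local C (e ∘ suc)) (te refl)
  guess-local (turn p q _ _ C) (suc v) e te = guess-local C v (e ∘ suc) λ Qv → cong (λ x → p ℕ.* (toℕ x / p)) (e zero Qv)

  -- The invariant: as long as every guess is wrong, the residue of the last clique's sum is one of
  -- the first `p`. It is trivial at `p = h`. A `grow` vertex bets on residue `p` and so removes it;
  -- a `turn` vertex removes the top window of length `q` from the residues of the new sum. At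
  -- `p = 0` nothing is left.
  guess-wins : (C : Chain h n p j) (c : Fin n → Fin h) (t : ℕ) →
    (∃[ v ] guess C v c t ≡ c v) ⊎ (offset C c ℕ.+ t) % h ℕ.< p
  guess-wins empty c t = inj₂ (m%n<n t h)
  guess-wins (grow {p = p} C) c t with guess-wins C (c ∘ suc) (toℕ (c zero) ℕ.+ t)
  ... | inj₁ (v , hit) = inj₁ (suc v , hit)
  ... | inj₂ small with growTarget? p (offset C (c ∘ suc)) t (c zero)
  ...   | yes e = inj₁ (zero , find-unique (growTarget? p (offset C (c ∘ suc)) t) e
            λ y e′ → toℕ-injective (%-+-cancelʳ h (s ℕ.+ t) (toℕ<n y) (toℕ<n (c zero))
              (trans (cong (_% h) (≡-sym (ℕP.+-assoc (toℕ y) s t))) (trans e′ (trans (≡-sym e) (cong (_% h) (ℕP.+-assoc (toℕ (c zero)) s t)))))))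
    where
    s : ℕ
    s = offset C (c ∘ suc)
  ...   | no ne = inj₂ (ℕP.≤∧≢⇒< (ℕP.≤-pred (subst (ℕ._< suc p) (cong (_% h) (rearrange (offset C (c ∘ suc)) (toℕ (c zero)) t)) small)) ne)
    where
    rearrange : ∀ s x t → s ℕ.+ (x ℕ.+ t) ≡ x ℕ.+ s ℕ.+ t
    rearrange = solve 3 (λ s x t → s :+ (x :+ t) := x :+ s :+ t) refl
      where open ℕ-Solver
  guess-wins (turn {p′ = p′} p q h≡pq h≡p′+q C) c t with guess-wins C (c ∘ suc) (p ℕ.* (toℕ (c zero) / p))
  ... | inj₁ (v , hit) = inj₁ (suc v , hit)
  ... | inj₂ small with (q ℕ.* (toℕ (c zero) % p) ℕ.+ t) % h / q ℕ.≟ ℕ.pred p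
  ...   | yes e = inj₁ (zero , find-unique (turnTarget? p q s t) target unique)
    where
    s : ℕ
    s = offset C (c ∘ suc)
    target : (p ℕ.* (toℕ (c zero) / p) ℕ.+ s) % h / p ≡ 0 × (q ℕ.* (toℕ (c zero) % p) ℕ.+ t) % h / q ≡ ℕ.pred p
    -- By the induction hypothesis the old residue lies in the first window of length `p`, so the
    -- half of the bet about the old clique is met.
    target = m<n⇒m/n≡0 (subst (λ m → m % h ℕ.< p) (ℕP.+-comm s (p ℕ.* (toℕ (c zero) / p))) small) , e
    quotient< : ∀ (x : Fin h) → toℕ x / p ℕ.< q
    quotient< x = m<n*o⇒m/o<n (subst (toℕ x ℕ.<_) (trans h≡pq (ℕP.*-comm p q)) (toℕ<n x))
    unique : ∀ y → (p ℕ.* (toℕ y / p) ℕ.+ s) % h / p ≡ 0 × (q ℕ.* (toℕ y % p) ℕ.+ t) % h / q ≡ ℕ.pred p → y ≡ c zero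
    unique y (e₁ , e₂) = toℕ-injective (trans (m≡m%n+[m/n]*n (toℕ y) p) (trans
      (cong₂ (λ b a → b ℕ.+ a ℕ.* p)
        (window-injective h q p (trans h≡pq (ℕP.*-comm p q)) t (m%n<n (toℕ y) p) (m%n<n (toℕ (c zero)) p) (trans e₂ (≡-sym (proj₂ target))))
        (window-injective h p q h≡pq s (quotient< y) (quotient< (c zero)) (trans e₁ (≡-sym (proj₁ target)))))
      (≡-sym (m≡m%n+[m/n]*n (toℕ (c zero)) p))))
  -- Outside the top window the quotient of `ρ` by `q` is at most `p - 2`, whence `ρ + q < p * q`.
  ...   | no ne = inj₂ (ℕP.+-cancelʳ-< q ρ p′ (begin-strict
          ρ ℕ.+ q                        ≡⟨ cong (ℕ._+ q) (m≡m%n+[m/n]*n ρ q) ⟩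
          ρ % q ℕ.+ ρ / q ℕ.* q ℕ.+ q    <⟨ ℕP.+-monoˡ-< q (ℕP.+-monoˡ-< (ρ / q ℕ.* q) (m%n<n ρ q)) ⟩
          suc (ρ / q) ℕ.* q ℕ.+ q        ≡⟨ ℕP.+-comm (suc (ρ / q) ℕ.* q) q ⟩
          suc (suc (ρ / q)) ℕ.* q        ≤⟨ ℕP.*-monoˡ-≤ q (not-last p (m<n*o⇒m/o<n (subst (ρ ℕ.<_) h≡pq (m%n<n _ h))) ne) ⟩
          p ℕ.* q                        ≡⟨ trans (≡-sym h≡pq) h≡p′+q ⟩
          p′ ℕ.+ q                       ∎))
    where
    open ℕP.≤-Reasoning
    ρ : ℕ
    ρ = (q ℕ.* (toℕ (c zero) % p) ℕ.+ t) % h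
    not-last : ∀ p {i} → i ℕ.< p → i ≢ ℕ.pred p → suc (suc i) ℕ.≤ p
    not-last (suc p) (s≤s i≤p) ne = s≤s (ℕP.≤∧≢⇒< i≤p ne)

  chain-winning : (C : Chain h n 0 j) → Winning (graph C) (★ h)
  chain-winning C = ((λ v c → guess C v c 0) , λ v c c′ e → guess-local C v e λ _ → refl) , wins
    where
    wins : ∀ c → ∃[ v ] guess C v c 0 ≡ c v
    wins c with guess-wins C c 0
    ... | inj₁ hit = hit

-- Walks and the diameter of a chain

walk-snoc : {G : Graph n} {u v w : Fin n} → Walk G u v k → adj G v w ≡ true → Walk G u w (suc k)
walk-snoc here       e = step e here
walk-snoc (step d W) e = step d (walk-snoc W e)

walk-reverse : {G : Graph n} {u v : Fin n} → Walk G u v k → Walk G v u k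
walk-reverse here               = here
walk-reverse {G = G} (step {u = u} {w = w} d W) = walk-snoc (walk-reverse W) (trans (sym G w u) d)

walk-attach : {G : Graph n} {Q : Fin n → Bool} {u v : Fin n} → Walk G u v k → Walk (attach G Q) (suc u) (suc v) k
walk-attach here       = here
walk-attach (step d W) = step d (walk-attach W)

-- The bound is strict to leave one step for reaching a vertex newly attached to the last clique.
near-clique : (C : Chain h n p j) (v : Fin n) → ∃[ w ] clique C w ≡ true × ∃[ k ] (k ℕ.< j × Walk (graph C) v w k)
near-clique (grow C)         zero    = zero , refl , 0 , s≤s z≤n , here
near-clique (grow C)         (suc v) = let w , Qw , k , k<j , W = near-clique C v in suc w , Qw , k , k<j , walk-attach W
near-clique (turn _ _ _ _ C) zero    = zero , refl , 0 , s≤s z≤n , here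
near-clique (turn _ _ _ _ C) (suc v) = let w , Qw , k , k<j , W = near-clique C v in zero , refl , suc k , s≤s k<j , walk-snoc (walk-attach W) Qw

attach-distance : (C : Chain h n p j) → (∀ u v → ∃[ k ] (k ℕ.≤ j × Walk (graph C) u v k)) →
  ∀ u v → ∃[ k ] (k ℕ.≤ j × Walk (attach (graph C) (clique C)) u v k)
attach-distance C short zero    zero    = 0 , z≤n , here
attach-distance C short zero    (suc v) = let w , Qw , k , k<j , W = near-clique C v in suc k , k<j , walk-reverse (walk-snoc (walk-attach W) Qw)
attach-distance C short (suc u) zero    = let w , Qw , k , k<j , W = near-clique C u in suc k , k<j , walk-snoc (walk-attach W) Qw
attach-distance C short (suc u) (suc v) = let k , k≤j , W = short u v in k , k≤j , walk-attach W

distance-≤ : (C : Chain h n p j) (u v : Fin n) → ∃[ k ] (k ℕ.≤ j × Walk (graph C) u v k)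
distance-≤ empty            ()
distance-≤ (grow C)         u v = attach-distance C (distance-≤ C) u v
distance-≤ (turn _ _ _ _ C) u v = let k , k≤j , W = attach-distance C (distance-≤ C) u v in k , ℕP.m≤n⇒m≤1+n k≤j , W

-- The number of the first clique containing the vertex, the empty chain counting as clique 0; this
-- is the distance from the very first vertex.
level : Chain h n p j → Fin n → ℕ
level (grow {j = j} C)         zero    = suc j
level (grow C)                 (suc v) = level C v
level (turn {j = j} _ _ _ _ C) zero    = j
level (turn _ _ _ _ C)         (suc v) = level C v

level-clique : (C : Chain h n p j) (v : Fin n) → clique C v ≡ true → level C v ℕ.≤ j × j ℕ.≤ suc (level C v)
level-clique (grow C)         zero    _  = ℕP.≤-refl , ℕP.n≤1+n _
level-clique (grow C)         (suc v) Qv = level-clique C v Qv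
level-clique (turn _ _ _ _ C) zero    _  = ℕP.n≤1+n _ , ℕP.≤-refl

level-adj : (C : Chain h n p j) (u v : Fin n) → adj (graph C) u v ≡ true → level C u ℕ.≤ suc (level C v)
level-adj (grow C)         zero    (suc v) Qv = proj₂ (level-clique C v Qv)
level-adj (grow C)         (suc u) zero    Qu = ℕP.m≤n⇒m≤1+n (proj₁ (level-clique C u Qu))
level-adj (grow C)         (suc u) (suc v) e  = level-adj C u v e
level-adj (turn _ _ _ _ C) zero    (suc v) Qv = proj₂ (level-clique C v Qv)
level-adj (turn _ _ _ _ C) (suc u) zero    Qu = ℕP.m≤n⇒m≤1+n (proj₁ (level-clique C u Qu))
level-adj (turn _ _ _ _ C) (suc u) (suc v) e  = level-adj C u v e

level-walk : (C : Chain h n p j) {u v : Fin n} → Walk (graph C) u v k → level C u ℕ.≤ k ℕ.+ level C v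
level-walk C here                   = ℕP.≤-refl
level-walk C (step {u} {w} d W) = ℕP.≤-trans (level-adj C u w d) (s≤s (level-walk C W))

bottom : (C : Chain h n p (suc j)) → ∃[ v ] level C v ≡ 0
bottom (grow C)                     = let v , e = bottom C in suc v , e
bottom (turn {j = zero}  _ _ _ _ C) = zero , refl
bottom (turn {j = suc _} _ _ _ _ C) = let v , e = bottom C in suc v , e

-- The lower bound is between the first vertex, of level 0, and the newest one, whose level is
-- `suc j` because it comes from `grow`; one edge changes the level by at most 1.
chain-diameter : (C : Chain h n (suc p) (suc j)) → Diameter (graph (grow C)) (suc j)
chain-diameter {j = j} C = distance-≤ (grow C) , zero , suc v , λ k k<d W →
    ℕP.<⇒≱ k<d (subst (suc j ℕ.≤_) (trans (cong (k ℕ.+_) (proj₂ (bottom C))) (ℕP.+-identityʳ k)) (level-walk (grow C) W))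
  where
  v = proj₁ (bottom C)

-- Clique sizes for `h = 2m`

descend : ∀ e → Chain h n (e ℕ.+ p) (suc j) → ∃[ n′ ] Chain h n′ p (suc j)
descend zero    C = _ , C
descend (suc e) C = descend e (grow C)

-- The summand `m` is kept for a next shared vertex, which takes `m/h = 1/2`, and `e` counts the
-- ordinary vertices to be placed before it: `m - 1` in the first clique, `m - 2` in a clique
-- entered through a shared vertex.
cliques : ∀ m → 2 ℕ.≤ m → ∀ j → ∃[ n ] ∃[ e ] Chain (m ℕ.* 2) n (e ℕ.+ m) (suc j)
-- The empty chain acts as a clique whose whole ratio `h/h` is free. Filling it with `q = 1` costs
-- nothing and gives the first vertex ratio `1/h` in the first real clique.
cliques m@(suc (suc l)) 2≤m zero    = _ , suc l , turn (m ℕ.* 2) 1 (≡-sym (ℕP.*-identityʳ (m ℕ.* 2))) (count l) empty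
  where
  count : ∀ l → suc (suc l) ℕ.* 2 ≡ suc l ℕ.+ suc (suc l) ℕ.+ 1
  count = solve 1 (λ l → (con 2 :+ l) :* con 2 := (con 1 :+ l) :+ (con 2 :+ l) :+ con 1) refl
    where open ℕ-Solver
cliques m@(suc (suc l)) 2≤m (suc j) = let _ , e , C = cliques m 2≤m j in
    _ , l , turn m 2 refl (count l) (proj₂ (descend e C))
  where
  count : ∀ l → suc (suc l) ℕ.* 2 ≡ l ℕ.+ suc (suc l) ℕ.+ 2
  count = solve 1 (λ l → (con 2 :+ l) :* con 2 := l :+ (con 2 :+ l) :+ con 2) refl
    where open ℕ-Solver
cliques (suc zero) (s≤s ())

-- One unit is left over so that the last vertex of the graph is added by `grow`, as
-- `chain-diameter` asks.
clique-chain : ∀ m → 2 ℕ.≤ m → ∀ j → ∃[ n ] Chain (m ℕ.* 2) n 1 (suc j)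
clique-chain m@(suc l) 2≤m j = let n , e , C = cliques m 2≤m j in
  descend (e ℕ.+ l) (subst (λ p → Chain (m ℕ.* 2) n p (suc j)) (trans (cong (e ℕ.+_) (ℕP.+-comm 1 l)) (≡-sym (ℕP.+-assoc e l 1))) C)

theorem6p3 : ∀ (d h0 : ℕ) .{{_ : NonZero h0}} → ¬ (2 ∣ d) → 2 ∣ h0 → 3 ℕ.< h0 →
    ∃[ n ] ∃[ G ] (Minimal {n} G h0 × Diameter G d × HGis G h0)
theorem6p3 zero    h0 odd even 3<h0 = contradiction (divides 0 refl) odd
theorem6p3 (suc j) h0 odd (divides m refl) 3<h0 = _ , graph (grow C) , minimal-C , chain-diameter C , proj₁ minimal-C
  where
  C : Chain (m ℕ.* 2) _ 1 (suc j)
  -- `3 < h0` reads `2 * 2 ≤ m * 2`, from which the factor 2 is cancelled.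
  C = proj₂ (clique-chain m (ℕP.*-cancelʳ-≤ 2 m 2 3<h0) j)
  minimal-C : Minimal (graph (grow C)) (m ℕ.* 2)
  minimal-C = minimal (graph (grow C)) (m ℕ.* 2) (chain-maximal (grow C)) (chain-winning (grow C))
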